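{- For each $r\ge 2$ and each $\pi\in\Pi_1(\{1,\dots,r\})$, the map $\psi_\pi:\mathcal{C}(\pi)\to\mathcal{E}(\pi)$ defined by the construction in the context is a bijection.
   Context: An unordered increasing tree is a rooted tree on distinct positive integers, sons unordered, each son larger than its father. $\Pi_1(\{1,\dots,r\})$ is the set of set partitions of $\{1,\dots,r\}$ having $\{1\}$ as a block; for such $\pi$ with $k$ blocks, index them $\pi_1,\dots,\pi_k$ so that $\mu_i=\max\pi_i$ satisfy $1=\mu_1<\dots<\mu_k=r$. $\mathcal{E}(\pi)$ is the set of unordered increasing trees on $\{1,\dots,r\}$ in which, for every two elements $i<j$ of the same block of $\pi$, $i$ is an ancestor of $j$. $\mathcal{C}(\pi)=\{(c_2,\dots,c_{k-1}):1\le c_i\le\mu_i\}$ (only the empty list if $k=2$). $v$-decomposition: for a vertex $v$ of an unordered increasing tree $T$ with chain $a_1<\dots<a_k=v$ from the root to $v$, removing the chain edges gives components $T^{(a_i)}$ rooted at $a_i$. Splice: for unordered increasing trees $T_1,T_2$ with disjoint vertex-sets and $v_1\in V(T_1)$, $v_2\in V(T_2)$, $v_1>v_2$, $\mathrm{spl}(T_1,v_1;T_2,v_2)$ is the tree on $V(T_1)\cup V(T_2)$ obtained by merging the root-to-$v_1$ chain of $T_1$ and the root-to-$v_2$ chain of $T_2$ into one increasing chain (root = smallest element, ending at $v_1$) and attaching at each chain vertex its component from the $v_1$-decomposition of $T_1$ or the $v_2$-decomposition of $T_2$. Construction of $\psi_\pi(c)$ for $c=(c_2,\dots,c_{k-1})\in\mathcal{C}(\pi)$: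 Stage 1: let $\tau_\ell$ be the increasing chain on the elements of $\pi_\ell$ ($\ell=1,\dots,k$), and set $\nu=1$. For $i=2,\dots,k-1$: if $c_i$ is a vertex of $\tau_1$ or $\tau_i$, replace $\tau_1$ by $\mathrm{spl}(\tau_i,\mu_i;\tau_1,\nu)$, discard $\tau_i$, and set $\nu=c_i$; otherwise $c_i$ is a vertex of some $\tau_j$ with $j>i$, and then replace $\tau_j$ by $\mathrm{spl}(\tau_i,\mu_i;\tau_j,c_i)$ and discard $\tau_i$. Finally $\psi_\pi(c)=\mathrm{spl}(\tau_k,\mu_k;\tau_1,\nu)$. -}

module Defs where

open import Data.Bool.Base using (if_then_else_)
open import Data.Fin.Base using (Fin; zero; suc; toℕ; inject₁; _≤_; _<_)
open import Data.Fin.Subset using (Subset; inside; outside; _∈_; _∪_; ⁅_⁆; ⊤)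
open import Data.Fin.Subset.Properties using (_∈?_)
open import Data.Maybe.Base as Maybe using (Maybe; just; nothing; maybe; _<∣>_)
open import Data.Nat.Base as ℕ using (ℕ; zero; suc)
open import Data.Product using (Σ-syntax; ∃!; _×_; proj₁)
open import Data.Vec.Base as Vec using (Vec; []; _∷_; lookup; tabulate)
open import Function.Base using (_∘_; _on_)
open import Function.Bundles using (_⇔_)
open import Relation.Binary.Construct.Closure.Transitive using (TransClosure)
open import Relation.Binary.PropositionalEquality using (_≡_; _≢_)
open import Relation.Nullary.Decidable using (does; _⊎-dec_)

-- Convention: x : Fin r stands for the integer 1 + toℕ x of {1,…,r}.

------------------------------------------------------------------------
-- Unordered increasing trees with vertices in {1,…,r}

-- A rooted tree with unordered sons is encoded by its vertex-set and its
-- father map (nothing at the root and off the vertex-set), so that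
-- propositional equality is equality of unordered labelled rooted trees.
-- RawTree is the bare data; IsIncreasingTree says that it is such a tree.

record RawTree (r : ℕ) : Set where
  constructor mkTree
  field
    vertices : Subset r
    fathers  : Vec (Maybe (Fin r)) r

  father : Fin r → Maybe (Fin r)
  father = lookup fathers

  IsFather : Fin r → Fin r → Set
  IsFather u v = father v ≡ just u

  Ancestor : Fin r → Fin r → Set
  Ancestor = TransClosure IsFather

open RawTree

record IsIncreasingTree {r : ℕ} (T : RawTree r) : Set where
  field
    root       : Fin r
    root∈      : root ∈ vertices T
    root-top   : father T root ≡ nothing
    edges      : ∀ {u v} → IsFather T u v → u ∈ vertices T × v ∈ vertices T
    connected  : ∀ {v} → v ∈ vertices T → v ≢ root → Ancestor T root v
    increasing : ∀ {u v} → IsFather T u v → u < v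

-- The largest element of S smaller than x, if there is one.
pred : ∀ {r} → Subset r → Fin r → Maybe (Fin r)
pred (_       ∷ S) zero    = nothing
pred (inside  ∷ S) (suc x) = Maybe.map suc (pred S x) <∣> just zero
pred (outside ∷ S) (suc x) = Maybe.map suc (pred S x)

increasingChain : ∀ {r} → Subset r → RawTree r
increasingChain S =
  mkTree S (tabulate λ x → if does (x ∈? S) then pred S x else nothing)

-- The set {a₁ < … < aₖ = v} of vertices of the chain from the root to v.
-- In a tree on at most r vertices, r steps upwards reach the root.
chain : ∀ {r} → RawTree r → Fin r → Subset r
chain {r} T = climb r
  where
  climb : ℕ → Fin r → Subset r
  climb zero    v = ⁅ v ⁆
  climb (suc n) v = maybe (λ u → ⁅ v ⁆ ∪ climb n u) ⁅ v ⁆ (father T v)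

-- The v-decomposition of T: the father map of the forest obtained by
-- removing the edges of the chain from the root to v.  Its components are
-- the trees T^(aᵢ), rooted at the elements aᵢ of the chain.
decompose : ∀ {r} → RawTree r → Fin r → Fin r → Maybe (Fin r)
decompose T v x = if does (x ∈? chain T v) then nothing else father T x

-- The splice, meaningful when T₁ and T₂ are increasing trees with disjoint
-- vertex-sets, v₁ ∈ T₁, v₂ ∈ T₂ and v₁ > v₂.  Its edges are those of the
-- merged chain together with those of the two decompositions.
spl : ∀ {r} → RawTree r → Fin r → RawTree r → Fin r → RawTree r
spl T₁ v₁ T₂ v₂ = mkTree (vertices T₁ ∪ vertices T₂) (tabulate λ x →
  father merged x <∣> decompose T₁ v₁ x <∣> decompose T₂ v₂ x)
  where merged = increasingChain (chain T₁ v₁ ∪ chain T₂ v₂)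

------------------------------------------------------------------------
-- Set partitions of {1,…,r} having {1} as a block

-- The blocks come in their unique indexing by increasing maxima.  Their
-- number is k = 2 + m: for r ≥ 2 there is a block besides {1}.  The block
-- {1} has the smallest maximum, hence is the first one.  The index
-- ℓ ∈ {1,…,k} is represented by the element ℓ - 1 of Fin k.

record Π₁ (r : ℕ) : Set where
  field
    m : ℕ

  k : ℕ
  k = 2 ℕ.+ m

  field
    block        : Fin k → Subset r
    partition    : ∀ x → ∃! _≡_ λ ℓ → x ∈ block ℓ
    μ            : Fin k → Fin r
    μ∈block      : ∀ ℓ → μ ℓ ∈ block ℓ
    μ-max        : ∀ ℓ {x} → x ∈ block ℓ → x ≤ μ ℓ
    μ-increasing : ∀ {ℓ ℓ′} → ℓ < ℓ′ → μ ℓ < μ ℓ′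
    block₁       : ∀ {x} → x ∈ block zero ⇔ suc (toℕ x) ≡ 1

record _∈ℰ_ {r : ℕ} (T : RawTree r) (π : Π₁ r) : Set where
  open Π₁ π
  field
    isIncreasingTree : IsIncreasingTree T
    spanning         : vertices T ≡ ⊤
    ancestors        : ∀ ℓ {i j} → i ∈ block ℓ → j ∈ block ℓ → i < j →
                       Ancestor T i j

module _ {r : ℕ} (π : Π₁ r) where
  open Π₁ π

  ℰ : Set
  ℰ = Σ[ T ∈ RawTree r ] T ∈ℰ π

  -- The list (c₂,…,c_{k-1}); its entry at position i : Fin m is c_{i+2}.
  𝒞 : Set
  𝒞 = Σ[ c ∈ Vec (Fin r) m ] (∀ i → lookup c i ≤ μ (suc (inject₁ i)))

  _≈𝒞_ : 𝒞 → 𝒞 → Set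
  _≈𝒞_ = _≡_ on proj₁

  _≈ℰ_ : ℰ → ℰ → Set
  _≈ℰ_ = _≡_ on proj₁

------------------------------------------------------------------------
-- The construction of ψ

-- Arguments, at the beginning of the step with index i: the current τ₁ and
-- ν, then (cᵢ,…,c_{k-1}), (μᵢ,…,μₖ) and the current (τᵢ,…,τₖ).
-- In the second alternative the vertex-sets are disjoint, so that only the
-- tree τⱼ containing cᵢ is replaced.
run : ∀ {r n} → RawTree r → Fin r →
      Vec (Fin r) n → Vec (Fin r) (suc n) → Vec (RawTree r) (suc n) → RawTree r
run τ₁ ν []       (μₖ ∷ []) (τₖ ∷ []) = spl τₖ μₖ τ₁ ν
run τ₁ ν (c ∷ cs) (μᵢ ∷ μs) (τᵢ ∷ τs) =
  if does (c ∈? vertices τ₁ ⊎-dec c ∈? vertices τᵢ)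
  then run (spl τᵢ μᵢ τ₁ ν) c cs μs τs
  else run τ₁ ν cs μs (Vec.map attach τs)
  where
  attach : RawTree _ → RawTree _
  attach τⱼ = if does (c ∈? vertices τⱼ) then spl τᵢ μᵢ τⱼ c else τⱼ

-- The initial value of ν is 1 = μ₁.
ψ : ∀ {r} (π : Π₁ r) → 𝒞 π → RawTree r
ψ π c = run (τ zero) (μ zero) (proj₁ c) (tabulate (μ ∘ suc)) (tabulate (τ ∘ suc))
  where
  open Π₁ π
  τ : Fin k → RawTree _
  τ ℓ = increasingChain (block ℓ)

{-# OPTIONS --safe #-}
module Submission where

-- Let M x be the largest element of the block of x.  Blocks are chains of a
-- tree T iff every x is a weak ancestor of M x.  For a vertex v, call two
-- vertices linked if they are related by the equivalence generated by "same
-- block" and "same component of the v-decomposition of T".  A component root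
-- y ≠ v is sent by y ↦ (meet of v and M y) to a component root that is y or
-- lies below y, so the classes correspond to the fixed points of this map, and
-- everything is linked to v iff for each y strictly above v the vertices v
-- and M y lie in the subtree of the same son of y.  Throughout the construction
-- every τⱼ with j ≥ 2 has this property with respect to μⱼ.
--
-- Therefore a splice S = spl(τᵢ,μᵢ;T,c) can be undone: τᵢ is the restriction
-- of S to the vertices linked to μᵢ, T is the restriction to the other ones
-- and c is the largest proper ancestor of μᵢ not linked to it.  Conversely, in
-- a later situation of the construction the vertices linked to μᵢ split off
-- the tree containing μᵢ: the class of μᵢ never contains 1, because {1} is a
-- block, nor μⱼ if μᵢ lies in τⱼ, because the meet x of μᵢ and μⱼ is a fixed
-- point.  Which of the two alternatives was taken in step i is seen from
-- whether μᵢ lies in τ₁.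

open import Defs
open import Data.Bool.Base using (if_then_else_)
open import Data.Empty using (⊥; ⊥-elim)
open import Data.Fin.Base using (Fin; zero; suc; toℕ; inject₁; _≤_; _<_)
import Data.Fin.Properties as Fin
open import Data.Fin.Subset
  using (Subset; inside; outside; _∈_; _∉_; _∪_; _∩_; _⊆_; ⁅_⁆; ⊤; Nonempty)
open import Data.Fin.Subset.Properties
  using (_∈?_; nonempty?; ∈⊤; x∈⁅x⁆; x∈⁅y⁆⇒x≡y; x∈p∪q⁺; x∈p∪q⁻; x∈p∩q⁺; x∈p∩q⁻; ⊆-antisym)
open import Data.Maybe.Base using (just; nothing; maybe; _<∣>_)
open import Data.Maybe.Properties using (just-injective)
open import Data.Nat.Base as ℕ using (ℕ; zero; suc; z≤n; s≤s)
import Data.Nat.Properties as ℕ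
open import Data.Product using (Σ-syntax; ∃; ∃-syntax; _×_; _,_; proj₁; proj₂)
open import Data.Sum.Base using (_⊎_; inj₁; inj₂; [_,_]′)
open import Data.Vec.Base as Vec using (Vec; []; _∷_; lookup; tabulate; _[_]≔_)
open import Data.Vec.Properties
  using (lookup∘tabulate; lookup⇒[]=; []=⇒lookup; tabulate∘lookup; tabulate-cong;
         lookup-map; map-cong; lookup∘update; lookup∘update′)
open import Function.Base using (_∘_; case_of_)
open import Function.Bundles using (Equivalence)
open import Function.Structures using (IsBijection)
import Relation.Binary.Construct.On as On
open import Relation.Binary.Construct.Closure.Transitive using ([_]; _∷_; _∷ʳ_)
open import Relation.Binary.Definitions using (tri<; tri≈; tri>)
open import Relation.Binary.PropositionalEquality
open import Relation.Nullary using (¬_; Dec; yes; no; contradiction)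
open import Relation.Nullary.Decidable using (does; map′; dec-true; dec-false; _×-dec_; _⊎-dec_; ¬?)
open RawTree

lookup-ext : ∀ {a} {A : Set a} {n} {xs ys : Vec A n} → (∀ i → lookup xs i ≡ lookup ys i) → xs ≡ ys
lookup-ext {xs = xs} {ys} eq =
  trans (sym (tabulate∘lookup xs)) (trans (tabulate-cong eq) (tabulate∘lookup ys))

-- The ancestor order

-- The function climb local to Defs.chain has no name outside chain, and in
-- chain T its number of steps is tied to the index r of T.  Abstracting over
-- suc n in the unfolding of chain T v separates the two; the solution of the
-- placeholder is then forced to be that local function.
mutual
  climb : ∀ {r} → RawTree r → ℕ → Fin r → Subset r
  climb T n v = _

  climb-unfold : ∀ {n} (T : RawTree (suc n)) (v : Fin (suc n)) {S} → chain T v ≡ S →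
                 maybe (λ u → ⁅ v ⁆ ∪ climb T n u) ⁅ v ⁆ (father T v) ≡ S
  climb-unfold {n} T v p with suc n
  ... | _ = trans {i = maybe (λ u → ⁅ v ⁆ ∪ climb T n u) ⁅ v ⁆ (father T v)} refl p

module _ {r : ℕ} where

  infix 4 _⊢_≼_

  data _⊢_≼_ (T : RawTree r) (x : Fin r) : Fin r → Set where
    here : T ⊢ x ≼ x
    step : ∀ {u y} → father T y ≡ just u → T ⊢ x ≼ u → T ⊢ x ≼ y

  ≼-trans : ∀ {T x y z} → T ⊢ x ≼ y → T ⊢ y ≼ z → T ⊢ x ≼ z
  ≼-trans p here       = p
  ≼-trans p (step e q) = step e (≼-trans p q)

  ≼-comparable : ∀ {T x y z} → T ⊢ x ≼ z → T ⊢ y ≼ z → T ⊢ x ≼ y ⊎ T ⊢ y ≼ x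
  ≼-comparable here       q    = inj₂ q
  ≼-comparable p@(step _ _) here = inj₁ p
  ≼-comparable (step e p) (step e′ q)
    with refl ← just-injective (trans (sym e) e′) = ≼-comparable p q

  ≼⇒Ancestor : ∀ {T x y} → T ⊢ x ≼ y → x ≢ y → Ancestor T x y
  ≼⇒Ancestor here x≢x = ⊥-elim (x≢x refl)
  ≼⇒Ancestor {x = x} (step {u} e p) _ with x Fin.≟ u
  ... | yes refl = [ e ]
  ... | no x≢u   = ≼⇒Ancestor p x≢u ∷ʳ e

  Ancestor⇒≼ : ∀ {T x y} → Ancestor T x y → T ⊢ x ≼ y
  Ancestor⇒≼ [ e ]   = step e here
  Ancestor⇒≼ (e ∷ a) = ≼-trans (step e here) (Ancestor⇒≼ a)

  record IsTree (T : RawTree r) : Set where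
    field
      root       : Fin r
      root∈      : root ∈ vertices T
      edges      : ∀ {u v} → father T v ≡ just u → u ∈ vertices T × v ∈ vertices T
      increasing : ∀ {u v} → father T v ≡ just u → u < v
      root≼      : ∀ {v} → v ∈ vertices T → T ⊢ root ≼ v

    ≼⇒≤ : ∀ {x y} → T ⊢ x ≼ y → x ≤ y
    ≼⇒≤ here       = ℕ.≤-refl
    ≼⇒≤ (step e p) = ℕ.≤-trans (≼⇒≤ p) (ℕ.<⇒≤ (increasing e))

    ≼-antisym : ∀ {x y} → T ⊢ x ≼ y → T ⊢ y ≼ x → x ≡ y
    ≼-antisym p q = Fin.≤-antisym (≼⇒≤ p) (≼⇒≤ q)

    -- The ancestors of one vertex form a chain along which labels increase, so on it the ancestor
    -- order can be read off from the labels.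
    ≼-below : ∀ {x y z} → T ⊢ x ≼ z → T ⊢ y ≼ z → x ≤ y → T ⊢ x ≼ y
    ≼-below p q x≤y with ≼-comparable p q
    ... | inj₁ x≼y = x≼y
    ... | inj₂ y≼x with refl ← Fin.≤-antisym x≤y (≼⇒≤ y≼x) = here

    ≼-source : ∀ {x y} → T ⊢ x ≼ y → y ∈ vertices T → x ∈ vertices T
    ≼-source here       y∈ = y∈
    ≼-source (step e p) y∈ = ≼-source p (proj₁ (edges e))

    ≼-target : ∀ {x y} → T ⊢ x ≼ y → x ∈ vertices T → y ∈ vertices T
    ≼-target here       x∈ = x∈
    ≼-target (step e p) x∈ = proj₂ (edges e)

    ≼⇒≡⊎∈ : ∀ {x y} → T ⊢ x ≼ y → x ≡ y ⊎ x ∈ vertices T × y ∈ vertices T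
    ≼⇒≡⊎∈ here       = inj₁ refl
    ≼⇒≡⊎∈ (step e p) = inj₂ (≼-source p (proj₁ (edges e)) , proj₂ (edges e))

  fromIncreasing : ∀ {T} → IsIncreasingTree T → IsTree T
  fromIncreasing {T} t = record
    { root = root ; root∈ = root∈ ; edges = edges ; increasing = increasing ; root≼ = root≼ }
    where
    open IsIncreasingTree t
    root≼ : ∀ {v} → v ∈ vertices T → T ⊢ root ≼ v
    root≼ {v} v∈ with v Fin.≟ root
    ... | yes refl  = here
    ... | no v≢root = Ancestor⇒≼ (connected v∈ v≢root)

  toIncreasing : ∀ {T} → IsTree T → IsIncreasingTree T
  toIncreasing {T} t = record
    { root = root ; root∈ = root∈ ; root-top = root-top ; edges = edges
    ; connected = λ v∈ v≢ → ≼⇒Ancestor (root≼ v∈) (v≢ ∘ sym) ; increasing = increasing }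
    where
    open IsTree t
    root-top : father T root ≡ nothing
    root-top with father T root in eq
    ... | nothing = refl
    ... | just u  = contradiction (≼⇒≤ (root≼ (proj₁ (edges eq)))) (ℕ.<⇒≱ (increasing eq))

  climb-self : ∀ (T : RawTree r) n v → v ∈ climb T n v
  climb-self T zero    v = x∈⁅x⁆ v
  climb-self T (suc n) v with father T v
  ... | nothing = x∈⁅x⁆ v
  ... | just u  = x∈p∪q⁺ (inj₁ (x∈⁅x⁆ v))

  ∈climb⇒≼ : ∀ (T : RawTree r) n {x v} → x ∈ climb T n v → T ⊢ x ≼ v
  ∈climb⇒≼ T zero    x∈ with refl ← x∈⁅y⁆⇒x≡y _ x∈ = here
  ∈climb⇒≼ T (suc n) {v = v} x∈ with father T v in eq
  ... | nothing with refl ← x∈⁅y⁆⇒x≡y _ x∈ = here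
  ... | just u with x∈p∪q⁻ ⁅ v ⁆ (climb T n u) x∈
  ...   | inj₁ x∈v with refl ← x∈⁅y⁆⇒x≡y _ x∈v = here
  ...   | inj₂ x∈u = step eq (∈climb⇒≼ T n x∈u)

  ∈chain⇒≼ : ∀ {T : RawTree r} {x v} → x ∈ chain T v → T ⊢ x ≼ v
  ∈chain⇒≼ {T} = ∈climb⇒≼ T r

  module _ {T : RawTree r} (t : IsTree T) where
    open IsTree t

    -- Labels drop strictly at each step upwards, so `toℕ v` steps already reach every ancestor of
    -- `v`.
    ≼⇒∈climb : ∀ {n x v} → toℕ v ℕ.≤ n → T ⊢ x ≼ v → x ∈ climb T n v
    ≼⇒∈climb {n} v≤n here = climb-self T n _
    ≼⇒∈climb {zero}  v≤n (step e p) = contradiction (ℕ.≤-trans (increasing e) v≤n) λ ()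
    ≼⇒∈climb {suc n} v≤n (step e p) rewrite e =
      x∈p∪q⁺ (inj₂ (≼⇒∈climb (ℕ.≤-pred (ℕ.≤-trans (increasing e) v≤n)) p))

    ≼⇒∈chain : ∀ {x v} → T ⊢ x ≼ v → x ∈ chain T v
    ≼⇒∈chain {v = v} = ≼⇒∈climb (ℕ.<⇒≤ (Fin.toℕ<n v))

    _≼?_ : ∀ x v → Dec (T ⊢ x ≼ v)
    x ≼? v = map′ ∈chain⇒≼ ≼⇒∈chain (x ∈? chain T v)

  -- The father of a vertex is its largest proper ancestor, hence determined by the order. Equality
  -- of trees is thereby reduced to equivalence of their ancestor orders.
  tree-ext : ∀ {T T′ : RawTree r} → IsTree T → IsTree T′ → vertices T ≡ vertices T′ →
             (∀ {x y} → T ⊢ x ≼ y → T′ ⊢ x ≼ y) → (∀ {x y} → T′ ⊢ x ≼ y → T ⊢ x ≼ y) → T ≡ T′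
  tree-ext {mkTree V F} {mkTree .V F′} t t′ refl ≼⇒≼′ ≼′⇒≼ = cong (mkTree V) (lookup-ext same)
    where
    module t = IsTree t
    module t′ = IsTree t′
    same : ∀ y → lookup F y ≡ lookup F′ y
    same y with lookup F y in e | lookup F′ y in e′
    ... | nothing | nothing = refl
    ... | just u  | nothing with ≼⇒≼′ (step e here)
    ...   | here = contradiction (t.increasing e) (ℕ.<-irrefl refl)
    ...   | step e″ _ = contradiction (trans (sym e′) e″) λ ()
    same y | nothing | just u with ≼′⇒≼ (step e′ here)
    ...   | here = contradiction (t′.increasing e′) (ℕ.<-irrefl refl)
    ...   | step e″ _ = contradiction (trans (sym e) e″) λ ()
    same y | just u | just u′ with ≼⇒≼′ (step e here) | ≼′⇒≼ (step e′ here)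
    ... | here | _ = contradiction (t.increasing e) (ℕ.<-irrefl refl)
    ... | step _ _ | here = contradiction (t′.increasing e′) (ℕ.<-irrefl refl)
    ... | step e₁ p | step e₂ q
      with refl ← trans (sym e₁) e′ | refl ← trans (sym e₂) e =
      cong just (Fin.≤-antisym (t′.≼⇒≤ p) (t.≼⇒≤ q))

  module _ {S : RawTree r} (R : Fin r → Fin r → Set)
           (R-increasing : ∀ {u v} → father S v ≡ just u → u < v)
           (R-unfold : ∀ {x y} → R x y → x ≡ y ⊎ ∃[ p ] father S y ≡ just p × R x p) where

    -- Unfolding `R` moves its lower argument to the father. Fathers are smaller, so this must end
    -- in an equality; `n` bounds the label of the lower argument.
    R⇒≼ : ∀ {x y} → R x y → S ⊢ x ≼ y
    R⇒≼ {x} {y} = go (toℕ y) ℕ.≤-refl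
      where
      go : ∀ n {y} → toℕ y ℕ.≤ n → R x y → S ⊢ x ≼ y
      go n y≤n xRy with R-unfold xRy
      ... | inj₁ refl = here
      go zero y≤n xRy | inj₂ (p , e , xRp) = contradiction (ℕ.≤-trans (R-increasing e) y≤n) λ ()
      go (suc n) y≤n xRy | inj₂ (p , e , xRp) =
        step e (go n (ℕ.≤-pred (ℕ.≤-trans (R-increasing e) y≤n)) xRp)

  ≼⇒R : ∀ {S : RawTree r} (R : Fin r → Fin r → Set) → (∀ {x} → R x x) →
        (∀ {x p y} → father S y ≡ just p → R x p → R x y) → ∀ {x y} → S ⊢ x ≼ y → R x y
  ≼⇒R R R-refl R-step here       = R-refl
  ≼⇒R R R-refl R-step (step e p) = R-step e (≼⇒R R R-refl R-step p)

-- Predecessors, extreme elements and comprehension in finite sets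

pred-nothing : ∀ {r} (S : Subset r) {x z} → pred S x ≡ nothing → z ∈ S → ¬ z < x
pred-nothing (inside  ∷ S) {suc x} e with pred S x
pred-nothing (inside  ∷ S) {suc x} () | just _
pred-nothing (inside  ∷ S) {suc x} () | nothing
pred-nothing (outside ∷ S) {suc x} e (Vec.there z∈) (s≤s z<x) with pred S x in eq
... | nothing = pred-nothing S eq z∈ z<x

pred-just : ∀ {r} (S : Subset r) {x p} → pred S x ≡ just p →
            p ∈ S × p < x × (∀ {z} → z ∈ S → z < x → z ≤ p)
pred-just (inside ∷ S) {suc x} e with pred S x in eq
pred-just (inside ∷ S) {suc x} refl | just p with p∈ , p<x , max ← pred-just S eq =
  Vec.there p∈ , s≤s p<x , λ { Vec.here _ → z≤n ; (Vec.there z∈) (s≤s z<x) → s≤s (max z∈ z<x) }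
pred-just (inside ∷ S) {suc x} refl | nothing =
  Vec.here , s≤s z≤n , λ { Vec.here _ → z≤n
                         ; (Vec.there z∈) (s≤s z<x) → contradiction z<x (pred-nothing S eq z∈) }
pred-just (outside ∷ S) {suc x} e with pred S x in eq
pred-just (outside ∷ S) {suc x} refl | just p with p∈ , p<x , max ← pred-just S eq =
  Vec.there p∈ , s≤s p<x , λ { (Vec.there z∈) (s≤s z<x) → s≤s (max z∈ z<x) }

pred-exists : ∀ {r} (S : Subset r) {x z} → z ∈ S → z < x → ∃[ p ] pred S x ≡ just p
pred-exists S {x} z∈ z<x with pred S x in eq
... | just p  = p , refl
... | nothing = contradiction z<x (pred-nothing S eq z∈)

largest : ∀ {r} (S : Subset r) → Nonempty S → ∃[ m ] m ∈ S × (∀ {x} → x ∈ S → x ≤ m)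
largest (s ∷ S) ne with nonempty? S
... | yes ne′ with m , m∈ , max ← largest S ne′ =
  suc m , Vec.there m∈ , λ { Vec.here → z≤n ; (Vec.there x∈) → s≤s (max x∈) }
largest (s ∷ S) (zero  , Vec.here)     | no e = zero , Vec.here ,
  λ { Vec.here → z≤n ; (Vec.there x∈) → contradiction (_ , x∈) e }
largest (s ∷ S) (suc x , Vec.there x∈) | no e = contradiction (x , x∈) e

smallest : ∀ {r} (S : Subset r) → Nonempty S → ∃[ m ] m ∈ S × (∀ {x} → x ∈ S → m ≤ x)
smallest (inside  ∷ S) _ = zero , Vec.here , λ _ → z≤n
smallest (outside ∷ S) (suc x , Vec.there x∈) with m , m∈ , min ← smallest S (x , x∈) =
  suc m , Vec.there m∈ , λ { (Vec.there y∈) → s≤s (min y∈) }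

module _ {r : ℕ} {P : Fin r → Set} (P? : ∀ x → Dec (P x)) where

  comprehension : Subset r
  comprehension = tabulate (does ∘ P?)

  ∈comprehension⁺ : ∀ {x} → P x → x ∈ comprehension
  ∈comprehension⁺ {x} p = lookup⇒[]= x _ (trans (lookup∘tabulate _ x) (dec-true (P? x) p))

  ∈comprehension⁻ : ∀ {x} → x ∈ comprehension → P x
  ∈comprehension⁻ {x} x∈ with P? x | trans (sym (lookup∘tabulate (does ∘ P?) x)) ([]=⇒lookup x∈)
  ... | yes p | _ = p

-- The increasing chain on a set

module _ {r : ℕ} (S : Subset r) where

  chain-father : ∀ {x} → x ∈ S → father (increasingChain S) x ≡ pred S x
  chain-father {x} x∈ rewrite lookup∘tabulate (λ x → if does (x ∈? S) then pred S x else nothing) x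
    | dec-true (x ∈? S) x∈ = refl

  chain-father∉ : ∀ {x} → x ∉ S → father (increasingChain S) x ≡ nothing
  chain-father∉ {x} x∉ rewrite lookup∘tabulate (λ x → if does (x ∈? S) then pred S x else nothing) x
    | dec-false (x ∈? S) x∉ = refl

  chain-father-just : ∀ {x p} → father (increasingChain S) x ≡ just p → x ∈ S × pred S x ≡ just p
  chain-father-just {x} e with x ∈? S
  ... | yes x∈ = x∈ , trans (sym (chain-father x∈)) e
  ... | no x∉  = contradiction (trans (sym (chain-father∉ x∉)) e) λ ()

  chain≼⇒≤ : ∀ {x y} → increasingChain S ⊢ x ≼ y → x ≡ y ⊎ x ∈ S × y ∈ S × x ≤ y
  chain≼⇒≤ = ≼⇒R (λ x y → x ≡ y ⊎ x ∈ S × y ∈ S × x ≤ y) (inj₁ refl) up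
    where
    up : ∀ {x p y} → father (increasingChain S) y ≡ just p → x ≡ p ⊎ x ∈ S × p ∈ S × x ≤ p →
         x ≡ y ⊎ x ∈ S × y ∈ S × x ≤ y
    up e xRp with y∈ , e′ ← chain-father-just e with p∈ , p<y , _ ← pred-just S e′ with xRp
    ... | inj₁ refl = inj₂ (p∈ , y∈ , ℕ.<⇒≤ p<y)
    ... | inj₂ (x∈ , _ , x≤p) = inj₂ (x∈ , y∈ , ℕ.≤-trans x≤p (ℕ.<⇒≤ p<y))

  ≤⇒chain≼ : ∀ {x y} → x ∈ S → y ∈ S → x ≤ y → increasingChain S ⊢ x ≼ y
  ≤⇒chain≼ x∈ y∈ x≤y = R⇒≼ (λ x y → x ∈ S × y ∈ S × x ≤ y)
    (λ e → proj₁ (proj₂ (pred-just S (proj₂ (chain-father-just e))))) down (x∈ , y∈ , x≤y)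
    where
    down : ∀ {x y} → x ∈ S × y ∈ S × x ≤ y →
           x ≡ y ⊎ ∃[ p ] father (increasingChain S) y ≡ just p × x ∈ S × p ∈ S × x ≤ p
    down {x} {y} (x∈ , y∈ , x≤y) with x Fin.≟ y
    ... | yes x≡y = inj₁ x≡y
    ... | no x≢y with p , e ← pred-exists S x∈ (Fin.≤∧≢⇒< x≤y x≢y)
      with p∈ , _ , max ← pred-just S e =
      inj₂ (p , trans (chain-father y∈) e , x∈ , p∈ , max x∈ (Fin.≤∧≢⇒< x≤y x≢y))

  chain-isTree : Nonempty S → IsTree (increasingChain S)
  chain-isTree ne with m , m∈ , min ← smallest S ne = record
    { root = m ; root∈ = m∈ ; root≼ = λ v∈ → ≤⇒chain≼ m∈ v∈ (min v∈)
    ; edges = λ e → let v∈ , e′ = chain-father-just e in proj₁ (pred-just S e′) , v∈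
    ; increasing = λ e → proj₁ (proj₂ (pred-just S (proj₂ (chain-father-just e)))) }

-- Splices

father∉ : ∀ {r} {T : RawTree r} → IsTree T → ∀ {y} → y ∉ vertices T → father T y ≡ nothing
father∉ {T = T} t {y} y∉ with father T y in e
... | nothing = refl
... | just u  = contradiction (proj₂ (IsTree.edges t e)) y∉

decompose-off : ∀ {r} (T : RawTree r) {v x} → x ∉ chain T v → decompose T v x ≡ father T x
decompose-off T {v} {x} x∉ rewrite dec-false (x ∈? chain T v) x∉ = refl

-- The ancestors of a vertex y of Tᵇ in a splice that come from Tᵃ.
Cross : ∀ {r} (Tᵃ : RawTree r) (a : Fin r) (Tᵇ : RawTree r) (b x y : Fin r) → Set
Cross Tᵃ a Tᵇ b x y = Tᵃ ⊢ x ≼ a × ∃[ z ] Tᵇ ⊢ z ≼ b × Tᵇ ⊢ z ≼ y × x < z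

Disjoint : ∀ {r} → RawTree r → RawTree r → Set
Disjoint T₁ T₂ = ∀ {x} → x ∈ vertices T₁ → x ∈ vertices T₂ → ⊥

module Splice {r : ℕ} {T₁ T₂ : RawTree r} {v₁ v₂ : Fin r} (t₁ : IsTree T₁) (t₂ : IsTree T₂)
  (disjoint : Disjoint T₁ T₂) (v₁∈ : v₁ ∈ vertices T₁) (v₂∈ : v₂ ∈ vertices T₂) where

  private
    module t₁ = IsTree t₁
    module t₂ = IsTree t₂
    S : RawTree r
    S = spl T₁ v₁ T₂ v₂
    K₁ K₂ K : Subset r
    K₁ = chain T₁ v₁
    K₂ = chain T₂ v₂
    K = K₁ ∪ K₂

  -- The ancestor order of the splice in terms of the orders of the two trees: a relation is an old
  -- one, or it passes once from one chain to a vertex `z` of the other.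
  data Below (x y : Fin r) : Set where
    in₁     : T₁ ⊢ x ≼ y → Below x y
    in₂     : T₂ ⊢ x ≼ y → Below x y
    cross₁₂ : Cross T₁ v₁ T₂ v₂ x y → Below x y
    cross₂₁ : Cross T₂ v₂ T₁ v₁ x y → Below x y

  private
    father-S : ∀ y → father S y ≡
      (father (increasingChain K) y <∣> decompose T₁ v₁ y <∣> decompose T₂ v₂ y)
    father-S y = lookup∘tabulate _ y

    father₁∉ : ∀ {y} → y ∈ vertices T₂ → father T₁ y ≡ nothing
    father₁∉ y∈₂ = father∉ t₁ (λ y∈₁ → disjoint y∈₁ y∈₂)

    K₁⊆ : ∀ {y} → T₁ ⊢ y ≼ v₁ → y ∈ vertices T₁
    K₁⊆ p = t₁.≼-source p v₁∈

    K₂⊆ : ∀ {y} → T₂ ⊢ y ≼ v₂ → y ∈ vertices T₂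
    K₂⊆ p = t₂.≼-source p v₂∈

    K⁻ : ∀ {y} → y ∈ K → T₁ ⊢ y ≼ v₁ ⊎ T₂ ⊢ y ≼ v₂
    K⁻ y∈ with x∈p∪q⁻ K₁ K₂ y∈
    ... | inj₁ y∈₁ = inj₁ (∈chain⇒≼ y∈₁)
    ... | inj₂ y∈₂ = inj₂ (∈chain⇒≼ y∈₂)

    K⁺₁ : ∀ {y} → T₁ ⊢ y ≼ v₁ → y ∈ K
    K⁺₁ p = x∈p∪q⁺ (inj₁ (≼⇒∈chain t₁ p))

    K⁺₂ : ∀ {y} → T₂ ⊢ y ≼ v₂ → y ∈ K
    K⁺₂ p = x∈p∪q⁺ {p = K₁} (inj₂ (≼⇒∈chain t₂ p))

    decompose₁ : ∀ {y} → y ∈ K → decompose T₁ v₁ y ≡ nothing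
    decompose₁ {y} y∈ with y ∈? K₁
    ... | yes y∈₁ = refl
    ... | no  y∉₁ with K⁻ y∈
    ...   | inj₁ p = contradiction (≼⇒∈chain t₁ p) y∉₁
    ...   | inj₂ p = father₁∉ (K₂⊆ p)

    decompose₂ : ∀ {y} → y ∈ K → decompose T₂ v₂ y ≡ nothing
    decompose₂ {y} y∈ with y ∈? K₂
    ... | yes y∈₂ = refl
    ... | no  y∉₂ with K⁻ y∈
    ...   | inj₁ p = father∉ t₂ (disjoint (K₁⊆ p))
    ...   | inj₂ p = contradiction (≼⇒∈chain t₂ p) y∉₂

    father-on : ∀ {y} → y ∈ K → father S y ≡ pred K y
    father-on {y} y∈ rewrite father-S y | chain-father K y∈ | decompose₁ y∈ | decompose₂ y∈
      with pred K y
    ... | just _  = refl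
    ... | nothing = refl

    father-off : ∀ {y} → y ∉ K → father S y ≡ (father T₁ y <∣> father T₂ y)
    father-off {y} y∉ rewrite father-S y | chain-father∉ K y∉
      | decompose-off T₁ {v₁} {y} (λ y∈ → y∉ (x∈p∪q⁺ (inj₁ y∈)))
      | decompose-off T₂ {v₂} {y} (λ y∈ → y∉ (x∈p∪q⁺ {p = K₁} (inj₂ y∈))) = refl

    father-off₁ : ∀ {y p} → y ∉ K → father T₁ y ≡ just p → father S y ≡ just p
    father-off₁ y∉ e rewrite father-off y∉ | e = refl

    father-off₂ : ∀ {y p} → y ∉ K → father T₂ y ≡ just p → father S y ≡ just p
    father-off₂ y∉ e rewrite father-off y∉ | father₁∉ (proj₂ (t₂.edges e)) = e

    data Father (p y : Fin r) : Set where
      on   : y ∈ K → p ∈ K → p < y → Father p y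
      off₁ : father T₁ y ≡ just p → Father p y
      off₂ : father T₂ y ≡ just p → Father p y

    father⁻ : ∀ {p y} → father S y ≡ just p → Father p y
    father⁻ {p} {y} e with y ∈? K
    ... | yes y∈ with p∈ , p<y , _ ← pred-just K (trans (sym (father-on y∈)) e) = on y∈ p∈ p<y
    ... | no  y∉ with father T₁ y in e₁ | trans (sym (father-off y∉)) e
    ...   | just _  | refl = off₁ e₁
    ...   | nothing | e₂   = off₂ e₂

    S-increasing : ∀ {p y} → father S y ≡ just p → p < y
    S-increasing e with father⁻ e
    ... | on _ _ p<y = p<y
    ... | off₁ e₁ = t₁.increasing e₁
    ... | off₂ e₂ = t₂.increasing e₂

    K-total : ∀ {x y} → x ∈ K → y ∈ K → x ≤ y → Below x y
    K-total {x} {y} x∈ y∈ x≤y with K⁻ x∈ | K⁻ y∈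
    ... | inj₁ p | inj₁ q = in₁ (t₁.≼-below p q x≤y)
    ... | inj₂ p | inj₂ q = in₂ (t₂.≼-below p q x≤y)
    ... | inj₁ p | inj₂ q =
      cross₁₂ (p , y , q , here , Fin.≤∧≢⇒< x≤y λ { refl → disjoint (K₁⊆ p) (K₂⊆ q) })
    ... | inj₂ p | inj₁ q =
      cross₂₁ (p , y , q , here , Fin.≤∧≢⇒< x≤y λ { refl → disjoint (K₁⊆ q) (K₂⊆ p) })

    below-K : ∀ {x y} → Below x y → y ∈ K → x ∈ K × x ≤ y
    below-K (in₁ p) y∈ with K⁻ y∈
    ... | inj₁ q = K⁺₁ (≼-trans p q) , t₁.≼⇒≤ p
    ... | inj₂ q with t₁.≼⇒≡⊎∈ p
    ...   | inj₁ refl = y∈ , ℕ.≤-refl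
    ...   | inj₂ (_ , y∈₁) = ⊥-elim (disjoint y∈₁ (K₂⊆ q))
    below-K (in₂ p) y∈ with K⁻ y∈
    ... | inj₂ q = K⁺₂ (≼-trans p q) , t₂.≼⇒≤ p
    ... | inj₁ q with t₂.≼⇒≡⊎∈ p
    ...   | inj₁ refl = y∈ , ℕ.≤-refl
    ...   | inj₂ (_ , y∈₂) = ⊥-elim (disjoint (K₁⊆ q) y∈₂)
    below-K (cross₁₂ (p , z , _ , z≼y , x<z)) y∈ =
      K⁺₁ p , ℕ.≤-trans (ℕ.<⇒≤ x<z) (t₂.≼⇒≤ z≼y)
    below-K (cross₂₁ (p , z , _ , z≼y , x<z)) y∈ =
      K⁺₂ p , ℕ.≤-trans (ℕ.<⇒≤ x<z) (t₁.≼⇒≤ z≼y)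

    below-up : ∀ {x p y} → father S y ≡ just p → Below x p → Below x y
    below-up e xRp with father⁻ e
    below-up e xRp | on y∈ p∈ p<y with x∈ , x≤p ← below-K xRp p∈ =
      K-total x∈ y∈ (ℕ.≤-trans x≤p (ℕ.<⇒≤ p<y))
    below-up e (in₁ q) | off₁ e₁ = in₁ (step e₁ q)
    below-up e (in₂ q) | off₂ e₂ = in₂ (step e₂ q)
    below-up e (in₂ q) | off₁ e₁ with t₂.≼⇒≡⊎∈ q
    ... | inj₁ refl = in₁ (step e₁ here)
    ... | inj₂ (_ , p∈₂) = ⊥-elim (disjoint (proj₁ (t₁.edges e₁)) p∈₂)
    below-up e (in₁ q) | off₂ e₂ with t₁.≼⇒≡⊎∈ q
    ... | inj₁ refl = in₂ (step e₂ here)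
    ... | inj₂ (_ , p∈₁) = ⊥-elim (disjoint p∈₁ (proj₁ (t₂.edges e₂)))
    below-up e (cross₁₂ (q , z , z≼v , z≼p , x<z)) | off₂ e₂ = cross₁₂ (q , z , z≼v , step e₂ z≼p , x<z)
    below-up e (cross₂₁ (q , z , z≼v , z≼p , x<z)) | off₁ e₁ = cross₂₁ (q , z , z≼v , step e₁ z≼p , x<z)
    below-up e (cross₁₂ (q , z , z≼v , z≼p , x<z)) | off₁ e₁ =
      ⊥-elim (disjoint (proj₁ (t₁.edges e₁)) (t₂.≼-target z≼p (K₂⊆ z≼v)))
    below-up e (cross₂₁ (q , z , z≼v , z≼p , x<z)) | off₂ e₂ =
      ⊥-elim (disjoint (t₁.≼-target z≼p (K₁⊆ z≼v)) (proj₁ (t₂.edges e₂)))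

    -- On the merged chain the father is `pred K y`. Off it, the father is the one in the tree of
    -- `y`, and a crossing keeps its `z` because `z` lies on the merged chain and so differs from
    -- `y`.
    below-down : ∀ {x y} → Below x y → x ≡ y ⊎ ∃[ p ] father S y ≡ just p × Below x p
    below-down {x} {y} xRy with y ∈? K
    below-down {x} {y} xRy | yes y∈ with x∈ , x≤y ← below-K xRy y∈ with x Fin.≟ y
    ... | yes x≡y = inj₁ x≡y
    ... | no x≢y with p , e ← pred-exists K x∈ (Fin.≤∧≢⇒< x≤y x≢y)
      with p∈ , _ , max ← pred-just K e =
      inj₂ (p , trans (father-on y∈) e , K-total x∈ p∈ (max x∈ (Fin.≤∧≢⇒< x≤y x≢y)))
    below-down (in₁ here) | no y∉ = inj₁ refl
    below-down (in₁ (step e p)) | no y∉ = inj₂ (_ , father-off₁ y∉ e , in₁ p)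
    below-down (in₂ here) | no y∉ = inj₁ refl
    below-down (in₂ (step e p)) | no y∉ = inj₂ (_ , father-off₂ y∉ e , in₂ p)
    below-down (cross₁₂ (p , z , q , here , x<z)) | no y∉ = contradiction (K⁺₂ q) y∉
    below-down (cross₁₂ (p , z , q , step e z≼p , x<z)) | no y∉ =
      inj₂ (_ , father-off₂ y∉ e , cross₁₂ (p , z , q , z≼p , x<z))
    below-down (cross₂₁ (p , z , q , here , x<z)) | no y∉ = contradiction (K⁺₁ q) y∉
    below-down (cross₂₁ (p , z , q , step e z≼p , x<z)) | no y∉ =
      inj₂ (_ , father-off₁ y∉ e , cross₂₁ (p , z , q , z≼p , x<z))

  ≼⇒below : ∀ {x y} → S ⊢ x ≼ y → Below x y
  ≼⇒below = ≼⇒R Below (in₁ here) below-up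

  below⇒≼ : ∀ {x y} → Below x y → S ⊢ x ≼ y
  below⇒≼ = R⇒≼ Below S-increasing below-down

  V₁⊆ : ∀ {x} → x ∈ vertices T₁ → x ∈ vertices S
  V₁⊆ x∈ = x∈p∪q⁺ (inj₁ x∈)

  V₂⊆ : ∀ {x} → x ∈ vertices T₂ → x ∈ vertices S
  V₂⊆ x∈ = x∈p∪q⁺ {p = vertices T₁} (inj₂ x∈)

  V⁻ : ∀ {x} → x ∈ vertices S → x ∈ vertices T₁ ⊎ x ∈ vertices T₂
  V⁻ = x∈p∪q⁻ (vertices T₁) (vertices T₂)

  private
    S-edges : ∀ {u v} → father S v ≡ just u → u ∈ vertices S × v ∈ vertices S
    S-edges e with father⁻ e
    ... | on v∈ u∈ _ = K⊆ u∈ , K⊆ v∈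
      where
      K⊆ : ∀ {x} → x ∈ K → x ∈ vertices S
      K⊆ x∈ with K⁻ x∈
      ... | inj₁ p = V₁⊆ (K₁⊆ p)
      ... | inj₂ p = V₂⊆ (K₂⊆ p)
    ... | off₁ e₁ = let u∈ , v∈ = t₁.edges e₁ in V₁⊆ u∈ , V₁⊆ v∈
    ... | off₂ e₂ = let u∈ , v∈ = t₂.edges e₂ in V₂⊆ u∈ , V₂⊆ v∈

  -- The root is the smaller one of the two roots. It reaches the other tree by a crossing in which
  -- the other root is `z`.
  spl-isTree : IsTree S
  spl-isTree with ℕ.≤-total (toℕ t₁.root) (toℕ t₂.root)
  ... | inj₁ le = record
    { root = t₁.root ; root∈ = V₁⊆ t₁.root∈ ; edges = S-edges ; increasing = S-increasing
    ; root≼ = λ {v} v∈ → case V⁻ v∈ of λ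
      { (inj₁ v∈₁) → below⇒≼ (in₁ (t₁.root≼ v∈₁))
      ; (inj₂ v∈₂) → below⇒≼ (cross₁₂ (t₁.root≼ v₁∈ , t₂.root , t₂.root≼ v₂∈ , t₂.root≼ v∈₂ ,
          Fin.≤∧≢⇒< le λ eq → disjoint t₁.root∈ (subst (_∈ vertices T₂) (sym eq) t₂.root∈))) } }
  ... | inj₂ le = record
    { root = t₂.root ; root∈ = V₂⊆ t₂.root∈ ; edges = S-edges ; increasing = S-increasing
    ; root≼ = λ {v} v∈ → case V⁻ v∈ of λ
      { (inj₂ v∈₂) → below⇒≼ (in₂ (t₂.root≼ v∈₂))
      ; (inj₁ v∈₁) → below⇒≼ (cross₂₁ (t₂.root≼ v₂∈ , t₁.root , t₁.root≼ v₁∈ , t₁.root≼ v∈₁ ,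
          Fin.≤∧≢⇒< le λ eq → disjoint t₁.root∈ (subst (_∈ vertices T₂) eq t₂.root∈))) } }

  -- Crossings join vertices of different trees only, so the splice induces the original order on
  -- each of the two vertex-sets.
  restrict₁ : ∀ {x y} → x ∈ vertices T₁ → y ∈ vertices T₁ → S ⊢ x ≼ y → T₁ ⊢ x ≼ y
  restrict₁ x∈ y∈ x≼y with ≼⇒below x≼y
  ... | in₁ p = p
  ... | in₂ p with t₂.≼⇒≡⊎∈ p
  ...   | inj₁ refl = here
  ...   | inj₂ (x∈₂ , _) = ⊥-elim (disjoint x∈ x∈₂)
  restrict₁ x∈ y∈ x≼y | cross₁₂ (_ , _ , q , z≼y , _) =
    ⊥-elim (disjoint y∈ (t₂.≼-target z≼y (K₂⊆ q)))
  restrict₁ x∈ y∈ x≼y | cross₂₁ (p , _) = ⊥-elim (disjoint x∈ (K₂⊆ p))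

  restrict₂ : ∀ {x y} → x ∈ vertices T₂ → y ∈ vertices T₂ → S ⊢ x ≼ y → T₂ ⊢ x ≼ y
  restrict₂ x∈ y∈ x≼y with ≼⇒below x≼y
  ... | in₂ p = p
  ... | in₁ p with t₁.≼⇒≡⊎∈ p
  ...   | inj₁ refl = here
  ...   | inj₂ (x∈₁ , _) = ⊥-elim (disjoint x∈₁ x∈)
  restrict₂ x∈ y∈ x≼y | cross₂₁ (_ , _ , q , z≼y , _) =
    ⊥-elim (disjoint (t₁.≼-target z≼y (K₁⊆ q)) y∈)
  restrict₂ x∈ y∈ x≼y | cross₁₂ (p , _) = ⊥-elim (disjoint (K₁⊆ p) x∈)

  crossing₁₂ : ∀ {x y} → x ∈ vertices T₁ → y ∈ vertices T₂ → S ⊢ x ≼ y → Cross T₁ v₁ T₂ v₂ x y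
  crossing₁₂ x∈ y∈ x≼y with ≼⇒below x≼y
  ... | cross₁₂ p = p
  ... | cross₂₁ (p , _) = ⊥-elim (disjoint x∈ (K₂⊆ p))
  ... | in₁ p = ⊥-elim (disjoint (t₁.≼-target p x∈) y∈)
  ... | in₂ p = ⊥-elim (disjoint x∈ (t₂.≼-source p y∈))

  crossing₂₁ : ∀ {x y} → x ∈ vertices T₂ → y ∈ vertices T₁ → S ⊢ x ≼ y → Cross T₂ v₂ T₁ v₁ x y
  crossing₂₁ x∈ y∈ x≼y with ≼⇒below x≼y
  ... | cross₂₁ p = p
  ... | cross₁₂ (p , _) = ⊥-elim (disjoint (K₁⊆ p) x∈)
  ... | in₂ p = ⊥-elim (disjoint y∈ (t₂.≼-target p x∈))
  ... | in₁ p = ⊥-elim (disjoint (t₁.≼-source p y∈) x∈)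

-- Unions of components of a decomposition

module _ {r : ℕ} where

  record IsMeet (T : RawTree r) (v y t : Fin r) : Set where
    constructor isMeet
    field
      ≼ˡ       : T ⊢ t ≼ v
      ≼ʳ       : T ⊢ t ≼ y
      greatest : ∀ {z} → T ⊢ z ≼ v → T ⊢ z ≼ y → T ⊢ z ≼ t

  open IsMeet

  -- The common ancestors lie on the chain of `v`, where the lowest one is the one with the largest
  -- label.
  meet : ∀ {T v y} → IsTree T → v ∈ vertices T → y ∈ vertices T → ∃ (IsMeet T v y)
  meet {T} {v} {y} t v∈ y∈
    with m , m∈ , max ← largest (chain T v ∩ chain T y)
           (IsTree.root t , x∈p∩q⁺ (≼⇒∈chain t (IsTree.root≼ t v∈) , ≼⇒∈chain t (IsTree.root≼ t y∈)))
    with m∈v , m∈y ← x∈p∩q⁻ (chain T v) (chain T y) m∈ =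
    m , isMeet (∈chain⇒≼ m∈v) (∈chain⇒≼ m∈y) λ p q →
      IsTree.≼-below t p (∈chain⇒≼ m∈v) (max (x∈p∩q⁺ (≼⇒∈chain t p , ≼⇒∈chain t q)))

  meet-unique : ∀ {T v y s t} → IsTree T → IsMeet T v y s → IsMeet T v y t → s ≡ t
  meet-unique t m m′ = IsTree.≼-antisym t (greatest m′ (≼ˡ m) (≼ʳ m)) (greatest m (≼ˡ m′) (≼ʳ m′))

  meet-≼ : ∀ {T v y} → T ⊢ y ≼ v → IsMeet T v y y
  meet-≼ p = isMeet p here λ _ q → q

  -- C is a union of components of the v-decomposition of T: the meet of v
  -- and y is the root of the component of y.
  Saturated : RawTree r → Fin r → Subset r → Set
  Saturated T v C = ∀ {y t} → y ∈ vertices T → IsMeet T v y t → (y ∈ C → t ∈ C) × (t ∈ C → y ∈ C)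

  -- The order induced on `C`: the new father of `y` is its lowest proper ancestor in `C`, which is
  -- the one with the largest label.
  restrict : RawTree r → Subset r → RawTree r
  restrict T C = mkTree C (tabulate λ y → if does (y ∈? C) then pred (chain T y ∩ C) y else nothing)

  module Restrict {T : RawTree r} (t : IsTree T) (C : Subset r) where
    open IsTree t

    private
      father-in : ∀ {y} → y ∈ C → father (restrict T C) y ≡ pred (chain T y ∩ C) y
      father-in {y} y∈
        rewrite lookup∘tabulate (λ y → if does (y ∈? C) then pred (chain T y ∩ C) y else nothing) y
              | dec-true (y ∈? C) y∈ = refl

      father⁻ : ∀ {y p} → father (restrict T C) y ≡ just p →
                y ∈ C × p ∈ C × T ⊢ p ≼ y × p < y
      father⁻ {y} e
        rewrite lookup∘tabulate (λ y → if does (y ∈? C) then pred (chain T y ∩ C) y else nothing) y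
        with y ∈? C
      ... | yes y∈ with p∈ , p<y , _ ← pred-just (chain T y ∩ C) e
        with p∈y , p∈C ← x∈p∩q⁻ (chain T y) C p∈ = y∈ , p∈C , ∈chain⇒≼ p∈y , p<y

    restrict⁻ : ∀ {x y} → restrict T C ⊢ x ≼ y → T ⊢ x ≼ y
    restrict⁻ = ≼⇒R (λ x y → T ⊢ x ≼ y) here λ e p → ≼-trans p (proj₁ (proj₂ (proj₂ (father⁻ e))))

    restrict⁺ : ∀ {x y} → x ∈ C → y ∈ C → T ⊢ x ≼ y → restrict T C ⊢ x ≼ y
    restrict⁺ x∈ y∈ p = R⇒≼ (λ x y → x ∈ C × y ∈ C × T ⊢ x ≼ y)
      (λ e → proj₂ (proj₂ (proj₂ (father⁻ e)))) down (x∈ , y∈ , p)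
      where
      down : ∀ {x y} → x ∈ C × y ∈ C × T ⊢ x ≼ y →
             x ≡ y ⊎ ∃[ p ] father (restrict T C) y ≡ just p × x ∈ C × p ∈ C × T ⊢ x ≼ p
      down {x} {y} (x∈ , y∈ , x≼y) with x Fin.≟ y
      ... | yes x≡y = inj₁ x≡y
      ... | no x≢y
        with x<y ← Fin.≤∧≢⇒< (≼⇒≤ x≼y) x≢y | x∈′ ← x∈p∩q⁺ (≼⇒∈chain t x≼y , x∈)
        with p , e ← pred-exists (chain T y ∩ C) x∈′ x<y
        with p∈ , _ , max ← pred-just (chain T y ∩ C) e
        with p∈y , p∈C ← x∈p∩q⁻ (chain T y) C p∈ =
        inj₂ (p , trans (father-in y∈) e , x∈ , p∈C , ≼-below x≼y (∈chain⇒≼ p∈y) (max x∈′ x<y))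

    -- The root is the first vertex `m` of `C` on the chain of `v`. The component root of any `y` in
    -- `C` is in `C` by saturation, hence lies between `m` and `y`; `w` ensures that `m` exists.
    restrict-isTree : ∀ {v w} → v ∈ vertices T → C ⊆ vertices T → Saturated T v C →
                      T ⊢ w ≼ v → w ∈ C → IsTree (restrict T C)
    restrict-isTree {v} {w} v∈ C⊆ sat w≼v w∈
      with m , m∈ , min ← smallest (chain T v ∩ C) (w , x∈p∩q⁺ (≼⇒∈chain t w≼v , w∈))
      with m∈v , m∈C ← x∈p∩q⁻ (chain T v) C m∈ = record
      { root = m ; root∈ = m∈C
      ; edges = λ e → let y∈ , p∈ , _ = father⁻ e in p∈ , y∈
      ; increasing = λ e → proj₂ (proj₂ (proj₂ (father⁻ e)))
      ; root≼ = λ {y} y∈ →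
          let s , s-meet = meet t v∈ (C⊆ y∈)
              s∈ = proj₁ (sat (C⊆ y∈) s-meet) y∈
          in restrict⁺ m∈C y∈ (≼-trans
               (≼-below (∈chain⇒≼ m∈v) (≼ˡ s-meet) (min (x∈p∩q⁺ (≼⇒∈chain t (≼ˡ s-meet) , s∈))))
               (≼ʳ s-meet)) }

-- Trees whose blocks are chains

module Blocks {r : ℕ} (M : Fin r → Fin r) (M-idem : ∀ x → M (M x) ≡ M x) where
  open IsMeet

  -- Blocks are the fibres of the idempotent map `M`. The vertex-set is a union of blocks by `M∈`
  -- and `M∈⁻`; each of these is a chain by `≼M`, since the ancestors of `M x` are linearly ordered.
  record Good (T : RawTree r) : Set where
    field
      isTree : IsTree T
      M∈     : ∀ {x} → x ∈ vertices T → M x ∈ vertices T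
      M∈⁻    : ∀ {x} → M x ∈ vertices T → x ∈ vertices T
      ≼M     : ∀ {x} → x ∈ vertices T → T ⊢ x ≼ M x
    open IsTree isTree public

  -- Every vertex is linked to v (see the header): the branches of T at y towards
  -- v and towards M y agree.
  Connected : RawTree r → Fin r → Set
  Connected T v = ∀ {y} → T ⊢ y ≼ v → y ≢ v → ∃[ w ] T ⊢ w ≼ v × T ⊢ w ≼ M y × y < w

  -- From the component root of `y`, pass repeatedly from the current vertex to the meet of `v` and
  -- its block maximum. By the hypothesis on `C` this descends the chain strictly, within `C`, until
  -- `v` is reached; membership in `C′` is then carried back from `v` along the same steps.
  saturated-⊆ : ∀ {T v C C′} → Good T → v ∈ vertices T → Saturated T v C → Saturated T v C′ →
    v ∈ C′ → (∀ {y} → y ∈ C → M y ∈ C) → (∀ {y} → M y ∈ C′ → y ∈ C′) →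
    (∀ {y} → y ∈ C → T ⊢ y ≼ v → y ≢ v → ∃[ w ] T ⊢ w ≼ v × T ⊢ w ≼ M y × y < w) →
    ∀ {y} → y ∈ vertices T → y ∈ C → y ∈ C′
  saturated-⊆ {T} {v} {C} {C′} g v∈ sat sat′ v∈C′ M∈C M∈C′⁻ con {y} y∈ y∈C =
    let s , s-meet = meet isTree v∈ y∈
    in proj₂ (sat′ y∈ s-meet)
         (go (toℕ v) (ℕ.m≤n+m (toℕ v) (toℕ s)) (≼ˡ s-meet) (proj₁ (sat y∈ s-meet) y∈C))
    where
    open Good g
    -- `n` bounds the difference of the labels of `v` and `y`, which decreases in each round.
    go : ∀ n {y} → toℕ v ℕ.≤ toℕ y ℕ.+ n → T ⊢ y ≼ v → y ∈ C → y ∈ C′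
    go n {y} v≤ y≼v y∈C with y Fin.≟ v
    ... | yes refl = v∈C′
    go zero {y} v≤ y≼v y∈C | no y≢v =
      contradiction (Fin.≤-antisym (≼⇒≤ y≼v) (subst (toℕ v ℕ.≤_) (ℕ.+-identityʳ _) v≤)) y≢v
    go (suc n) {y} v≤ y≼v y∈C | no y≢v
      with w , w≼v , w≼My , y<w ← con y∈C y≼v y≢v
      with My∈ ← M∈ (≼-source y≼v v∈)
      with s , s-meet ← meet isTree v∈ My∈ =
      M∈C′⁻ (proj₂ (sat′ My∈ s-meet) (go n v≤′ (≼ˡ s-meet) (proj₁ (sat My∈ s-meet) (M∈C y∈C))))
      where
      v≤′ : toℕ v ℕ.≤ toℕ s ℕ.+ n
      v≤′ = ℕ.≤-trans v≤ (subst (ℕ._≤ toℕ s ℕ.+ n) (sym (ℕ.+-suc (toℕ y) n))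
              (ℕ.+-monoˡ-≤ n (ℕ.≤-trans y<w (≼⇒≤ (greatest s-meet w≼v w≼My)))))

  -- Uniqueness of the parts of a splice

  record Spliceable (T₁ : RawTree r) (v : Fin r) (T₂ : RawTree r) (c : Fin r) : Set where
    field
      good₁     : Good T₁
      good₂     : Good T₂
      disjoint  : Disjoint T₁ T₂
      v∈        : v ∈ vertices T₁
      c∈        : c ∈ vertices T₂
      c<v       : c < v
      connected : Connected T₁ v

    module g₁ = Good good₁
    module g₂ = Good good₂
    open Splice g₁.isTree g₂.isTree disjoint v∈ c∈ public

    spl-good : Good (spl T₁ v T₂ c)
    spl-good = record
      { isTree = spl-isTree
      ; M∈ = λ x∈ → case V⁻ x∈ of λ
          { (inj₁ x∈₁) → V₁⊆ (g₁.M∈ x∈₁) ; (inj₂ x∈₂) → V₂⊆ (g₂.M∈ x∈₂) }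
      ; M∈⁻ = λ x∈ → case V⁻ x∈ of λ
          { (inj₁ x∈₁) → V₁⊆ (g₁.M∈⁻ x∈₁) ; (inj₂ x∈₂) → V₂⊆ (g₂.M∈⁻ x∈₂) }
      ; ≼M = λ x∈ → case V⁻ x∈ of λ
          { (inj₁ x∈₁) → below⇒≼ (in₁ (g₁.≼M x∈₁)) ; (inj₂ x∈₂) → below⇒≼ (in₂ (g₂.≼M x∈₂)) } }

    ≼c⇒≼v : ∀ {z} → T₂ ⊢ z ≼ c → spl T₁ v T₂ c ⊢ z ≼ v
    ≼c⇒≼v z≼c = below⇒≼ (cross₂₁ (z≼c , v , here , here , ℕ.≤-<-trans (g₂.≼⇒≤ z≼c) c<v))

    -- If a vertex and its component root came from different trees, the crossing between them would
    -- provide a common ancestor `z` of `v` and the vertex that is larger than their meet.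
    V₁-saturated : Saturated (spl T₁ v T₂ c) v (vertices T₁)
    V₁-saturated {y} {t} y∈ m = ⇒ , ⇐
      where
      module s = IsTree spl-isTree
      ⇒ : y ∈ vertices T₁ → t ∈ vertices T₁
      ⇒ y∈₁ with V⁻ (s.≼-source (≼ʳ m) y∈)
      ... | inj₁ t∈₁ = t∈₁
      ... | inj₂ t∈₂ with _ , z , z≼v , z≼y , t<z ← crossing₂₁ t∈₂ y∈₁ (≼ʳ m) =
        contradiction (s.≼⇒≤ (greatest m (below⇒≼ (in₁ z≼v)) (below⇒≼ (in₁ z≼y)))) (ℕ.<⇒≱ t<z)
      ⇐ : t ∈ vertices T₁ → y ∈ vertices T₁
      ⇐ t∈₁ with V⁻ y∈
      ... | inj₁ y∈₁ = y∈₁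
      ... | inj₂ y∈₂ with _ , z , z≼c , z≼y , t<z ← crossing₁₂ t∈₁ y∈₂ (≼ʳ m) =
        contradiction (s.≼⇒≤ (greatest m (≼c⇒≼v z≼c) (below⇒≼ (in₂ z≼y)))) (ℕ.<⇒≱ t<z)

    V₂-saturated : Saturated (spl T₁ v T₂ c) v (vertices T₂)
    V₂-saturated {y} {t} y∈ m with ⇒ , ⇐ ← V₁-saturated y∈ m = ⇒₂ , ⇐₂
      where
      ⇒₂ : y ∈ vertices T₂ → t ∈ vertices T₂
      ⇒₂ y∈₂ with V⁻ (IsTree.≼-source spl-isTree (≼ʳ m) y∈)
      ... | inj₁ t∈₁ = ⊥-elim (disjoint (⇐ t∈₁) y∈₂)
      ... | inj₂ t∈₂ = t∈₂
      ⇐₂ : t ∈ vertices T₂ → y ∈ vertices T₂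
      ⇐₂ t∈₂ with V⁻ y∈
      ... | inj₁ y∈₁ = ⊥-elim (disjoint (⇒ y∈₁) t∈₂)
      ... | inj₂ y∈₂ = y∈₂

    V₁-connected : ∀ {y} → y ∈ vertices T₁ → spl T₁ v T₂ c ⊢ y ≼ v → y ≢ v →
      ∃[ w ] spl T₁ v T₂ c ⊢ w ≼ v × spl T₁ v T₂ c ⊢ w ≼ M y × y < w
    V₁-connected y∈ y≼v y≢v with w , p , q , y<w ← connected (restrict₁ y∈ v∈ y≼v) y≢v =
      w , below⇒≼ (in₁ p) , below⇒≼ (in₁ q) , y<w

    -- Preserves the property of τⱼ with respect to μⱼ when τᵢ is spliced into it.
    spl-connected : ∀ {u} → u ∈ vertices T₂ → Connected T₂ u → Connected (spl T₁ v T₂ c) u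
    spl-connected u∈ con {y} y≼u y≢u with V⁻ (IsTree.≼-source spl-isTree y≼u (V₂⊆ u∈))
    ... | inj₂ y∈₂ with w , p , q , y<w ← con (restrict₂ y∈₂ u∈ y≼u) y≢u =
      w , below⇒≼ (in₂ p) , below⇒≼ (in₂ q) , y<w
    ... | inj₁ y∈₁ with y≼v , z , z≼c , z≼u , y<z ← crossing₁₂ y∈₁ u∈ y≼u
      with w , w≼v , w≼My , y<w ← connected y≼v
             (λ { refl → ℕ.<-asym y<z (ℕ.≤-<-trans (g₂.≼⇒≤ z≼c) c<v) })
      -- Both `w` and `z` lie on the merged chain below `y`. One leads to `M y` and the other to
      -- `u`, so the smaller one is an ancestor of both.
      with Fin.<-cmp w z
    ... | tri< w<z _ _ = w , below⇒≼ (cross₁₂ (w≼v , z , z≼c , z≼u , w<z)) , below⇒≼ (in₁ w≼My) , y<w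
    ... | tri≈ _ refl _ = ⊥-elim (disjoint (g₁.≼-source w≼v v∈) (g₂.≼-source z≼c c∈))
    ... | tri> _ _ z<w = z , below⇒≼ (in₂ z≼u) , below⇒≼ (cross₂₁ (z≼c , w , w≼v , w≼My , z<w)) , y<z

  -- All of `vertices T₁` is linked to `v` inside the splice, hence it lies in every saturated union
  -- of blocks that contains `v`; `vertices T₁′` is one.
  splice-⊆₁ : ∀ {T₁ T₁′ T₂ T₂′ v c c′} → Spliceable T₁ v T₂ c → Spliceable T₁′ v T₂′ c′ →
              spl T₁ v T₂ c ≡ spl T₁′ v T₂′ c′ → vertices T₁ ⊆ vertices T₁′
  splice-⊆₁ {T₁′ = T₁′} {v = v} s s′ eq x∈ = saturated-⊆ s.spl-good (s.V₁⊆ s.v∈) s.V₁-saturated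
    (subst (λ S → Saturated S v (vertices T₁′)) (sym eq) s′.V₁-saturated)
    s′.v∈ s.g₁.M∈ s′.g₁.M∈⁻ s.V₁-connected (s.V₁⊆ x∈) x∈
    where
    module s = Spliceable s
    module s′ = Spliceable s′

  module _ {T₁ T₁′ T₂ T₂′ v c c′} (s : Spliceable T₁ v T₂ c) (s′ : Spliceable T₁′ v T₂′ c′)
           (eq : spl T₁ v T₂ c ≡ spl T₁′ v T₂′ c′) where
    private
      module s = Spliceable s
      module s′ = Spliceable s′

    splice-⊆₂ : vertices T₂ ⊆ vertices T₂′
    splice-⊆₂ x∈ with s′.V⁻ (subst (λ S → _ ∈ vertices S) eq (s.V₂⊆ x∈))
    ... | inj₁ x∈₁ = ⊥-elim (s.disjoint (splice-⊆₁ s′ s (sym eq) x∈₁) x∈)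
    ... | inj₂ x∈₂ = x∈₂

    splice-≼₁ : ∀ {x y} → T₁ ⊢ x ≼ y → T₁′ ⊢ x ≼ y
    splice-≼₁ p with s.g₁.≼⇒≡⊎∈ p
    ... | inj₁ refl = here
    ... | inj₂ (x∈ , y∈) = s′.restrict₁ (splice-⊆₁ s s′ eq x∈) (splice-⊆₁ s s′ eq y∈)
                             (subst (_⊢ _ ≼ _) eq (s.below⇒≼ (s.in₁ p)))

    splice-≼₂ : ∀ {x y} → T₂ ⊢ x ≼ y → T₂′ ⊢ x ≼ y
    splice-≼₂ p with s.g₂.≼⇒≡⊎∈ p
    ... | inj₁ refl = here
    ... | inj₂ (x∈ , y∈) = s′.restrict₂ (splice-⊆₂ x∈) (splice-⊆₂ y∈)
                             (subst (_⊢ _ ≼ _) eq (s.below⇒≼ (s.in₂ p)))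

    -- A vertex of `T₂′` above `v` can get there only by a crossing, which starts on the chain to
    -- `c′`; `c` is such a vertex.
    splice-c≤ : c ≤ c′
    splice-c≤ = s′.g₂.≼⇒≤ (proj₁ (s′.crossing₂₁ (splice-⊆₂ s.c∈) s′.v∈
                  (subst (_⊢ c ≼ v) eq (s.≼c⇒≼v here))))

  spl-injective : ∀ {T₁ T₁′ T₂ T₂′ v c c′} → Spliceable T₁ v T₂ c → Spliceable T₁′ v T₂′ c′ →
    spl T₁ v T₂ c ≡ spl T₁′ v T₂′ c′ → T₁ ≡ T₁′ × T₂ ≡ T₂′ × c ≡ c′
  spl-injective s s′ eq =
      tree-ext s.g₁.isTree s′.g₁.isTree
        (⊆-antisym (splice-⊆₁ s s′ eq) (splice-⊆₁ s′ s (sym eq)))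
        (splice-≼₁ s s′ eq) (splice-≼₁ s′ s (sym eq))
    , tree-ext s.g₂.isTree s′.g₂.isTree
        (⊆-antisym (splice-⊆₂ s s′ eq) (splice-⊆₂ s′ s (sym eq)))
        (splice-≼₂ s s′ eq) (splice-≼₂ s′ s (sym eq))
    , Fin.≤-antisym (splice-c≤ s s′ eq) (splice-c≤ s′ s (sym eq))
    where
    module s = Spliceable s
    module s′ = Spliceable s′

  -- The class of the vertices linked to a block maximum

  module Class {T : RawTree r} {v : Fin r} (g : Good T) (v∈ : v ∈ vertices T) (Mv≡v : M v ≡ v) where
    open Good g

    -- The class of v: since each class contains one fixed point, it suffices to
    -- follow y ↦ (meet of v and M y).
    data Linked : Fin r → Set where
      top : Linked v
      up  : ∀ {y t} → y ∈ vertices T → IsMeet T v (M y) t → Linked t → Linked y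

    linked∈ : ∀ {y} → Linked y → y ∈ vertices T
    linked∈ top        = v∈
    linked∈ (up y∈ _ _) = y∈

    linked-up : ∀ {y t} → Linked y → IsMeet T v (M y) t → Linked t
    linked-up top m = subst Linked
      (meet-unique isTree (subst (λ u → IsMeet T v u v) (sym Mv≡v) (meet-≼ here)) m) top
    linked-up (up _ m′ l) m = subst Linked (meet-unique isTree m′ m) l

    -- At a fixed point `up` only leads back to the same vertex, so no derivation gets to `top`.
    fixed-unlinked : ∀ {y} → IsMeet T v (M y) y → y ≢ v → ¬ Linked y
    fixed-unlinked m y≢v top = y≢v refl
    fixed-unlinked m y≢v (up _ m′ l) with refl ← meet-unique isTree m m′ = fixed-unlinked m y≢v l

    -- After the first step the iterates stay on the chain of `v`. They descend it strictly until
    -- they stop at `v`, which is linked, or at another fixed point, which is not.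
    linked? : ∀ y → Dec (Linked y)
    linked? y with y ∈? vertices T
    ... | no y∉ = no (y∉ ∘ linked∈)
    ... | yes y∈ with s , m ← meet isTree v∈ (M∈ y∈) =
      map′ (up y∈ m) (λ l → linked-up l m) (go (toℕ v) (ℕ.m≤n+m (toℕ v) (toℕ s)) (≼ˡ m))
      where
      go : ∀ n {y} → toℕ v ℕ.≤ toℕ y ℕ.+ n → T ⊢ y ≼ v → Dec (Linked y)
      go n {y} v≤ y≼v with y Fin.≟ v
      ... | yes refl = yes top
      go zero {y} v≤ y≼v | no y≢v =
        contradiction (Fin.≤-antisym (≼⇒≤ y≼v) (subst (toℕ v ℕ.≤_) (ℕ.+-identityʳ _) v≤)) y≢v
      go (suc n) {y} v≤ y≼v | no y≢v
        with y∈ ← ≼-source y≼v v∈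
        with s , m ← meet isTree v∈ (M∈ y∈)
        with s Fin.≟ y
      ... | yes refl = no (fixed-unlinked m y≢v)
      ... | no s≢y = map′ (up y∈ m) (λ l → linked-up l m) (go n v≤′ (≼ˡ m))
        where
        v≤′ : toℕ v ℕ.≤ toℕ s ℕ.+ n
        v≤′ = ℕ.≤-trans v≤ (subst (ℕ._≤ toℕ s ℕ.+ n) (sym (ℕ.+-suc (toℕ y) n))
                (ℕ.+-monoˡ-≤ n (Fin.≤∧≢⇒< (≼⇒≤ (greatest m y≼v (≼M y∈))) (s≢y ∘ sym))))

    linked-M : ∀ {y} → Linked y → Linked (M y)
    linked-M {y} l with s , m ← meet isTree v∈ (M∈ (linked∈ l)) =
      up (M∈ (linked∈ l)) (subst (λ u → IsMeet T v u s) (sym (M-idem y)) m) (linked-up l m)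

    linked-M⁻ : ∀ {y} → Linked (M y) → Linked y
    linked-M⁻ {y} l with s , m ← meet isTree v∈ (linked∈ l) =
      up (M∈⁻ (linked∈ l)) m (linked-up l (subst (λ u → IsMeet T v u s) (sym (M-idem y)) m))

    -- `M y` is below `y`, so when `y` is off the chain of `v`, the path from `y` down to `M y`
    -- avoids this chain and the meet does not change.
    meet-M : ∀ {y t} → y ∈ vertices T → ¬ T ⊢ y ≼ v → IsMeet T v y t → IsMeet T v (M y) t
    meet-M {y} y∈ y⋠v m = isMeet (≼ˡ m) (≼-trans (≼ʳ m) (≼M y∈)) λ {z} z≼v z≼My →
      case ≼-comparable z≼My (≼M y∈) of λ
        { (inj₁ z≼y) → greatest m z≼v z≼y ; (inj₂ y≼z) → contradiction (≼-trans y≼z z≼v) y⋠v }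

    linked-meet : ∀ {y t} → y ∈ vertices T → IsMeet T v y t →
                  (Linked y → Linked t) × (Linked t → Linked y)
    linked-meet {y} y∈ m with _≼?_ isTree y v
    ... | yes y≼v with refl ← meet-unique isTree m (meet-≼ y≼v) = (λ l → l) , λ l → l
    ... | no y⋠v = (λ l → linked-up l (meet-M y∈ y⋠v m)) , up y∈ (meet-M y∈ y⋠v m)

    -- The witness is the meet of `v` and `M y`: a linked vertex other than `v` is no fixed point,
    -- so this meet is strictly below `y`.
    linked-connected : ∀ {y} → Linked y → T ⊢ y ≼ v → y ≢ v →
      ∃[ w ] Linked w × T ⊢ w ≼ v × T ⊢ w ≼ M y × y < w
    linked-connected {y} l y≼v y≢v with s , m ← meet isTree v∈ (M∈ (linked∈ l)) with s Fin.≟ y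
    ... | yes refl = contradiction l (fixed-unlinked m y≢v)
    ... | no s≢y = s , linked-up l m , ≼ˡ m , ≼ʳ m ,
      Fin.≤∧≢⇒< (≼⇒≤ (greatest m y≼v (≼M (linked∈ l)))) (s≢y ∘ sym)

  -- Undoing a splice

  module _ {T : RawTree r} {v : Fin r} (t : IsTree T) (v∈ : v ∈ vertices T)
    {C D : Subset r} (C⊆ : C ⊆ vertices T) (D⊆ : D ⊆ vertices T)
    (cover : ∀ {x} → x ∈ vertices T → x ∈ C ⊎ x ∈ D) (C∩D : ∀ {x} → x ∈ C → x ∈ D → ⊥)
    (satC : Saturated T v C) (satD : Saturated T v D) (v∈C : v ∈ C)
    {c : Fin r} (c≼v : T ⊢ c ≼ v) (c∈D : c ∈ D) (c-max : ∀ {x} → T ⊢ x ≼ v → x ∈ D → x ≤ c) where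

    private
      module t = IsTree t
      module C = Restrict t C
      module D = Restrict t D
      tC : IsTree (restrict T C)
      tC = C.restrict-isTree v∈ C⊆ satC here v∈C
      tD : IsTree (restrict T D)
      tD = D.restrict-isTree v∈ D⊆ satD c≼v c∈D
      open Splice tC tD C∩D v∈C c∈D

      ≼c : ∀ {x} → T ⊢ x ≼ v → x ∈ D → restrict T D ⊢ x ≼ c
      ≼c x≼v x∈ = D.restrict⁺ x∈ c∈D (t.≼-below x≼v c≼v (c-max x≼v x∈))

      -- An ancestor of `y` is either in the component of `y` or on the chain strictly above the
      -- root `s` of this component.
      above-meet : ∀ {x y s} → x ∈ vertices T → T ⊢ x ≼ y → IsMeet T v y s →
        ¬ IsMeet T v x s → T ⊢ x ≼ s × x < s
      above-meet x∈ x≼y m ¬m with ≼-comparable x≼y (≼ʳ m)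
      ... | inj₁ x≼s = x≼s , Fin.≤∧≢⇒< (t.≼⇒≤ x≼s) λ { refl → ¬m (meet-≼ (≼ˡ m)) }
      ... | inj₂ s≼x = contradiction
        (isMeet (≼ˡ m) s≼x λ z≼v z≼x → greatest m z≼v (≼-trans z≼x x≼y)) ¬m

      to : ∀ {x y} → T ⊢ x ≼ y → Below x y
      to x≼y with t.≼⇒≡⊎∈ x≼y
      ... | inj₁ refl = in₁ here
      ... | inj₂ (x∈ , y∈) with cover x∈ | cover y∈
      ...   | inj₁ x∈C | inj₁ y∈C = in₁ (C.restrict⁺ x∈C y∈C x≼y)
      ...   | inj₂ x∈D | inj₂ y∈D = in₂ (D.restrict⁺ x∈D y∈D x≼y)
      ...   | inj₁ x∈C | inj₂ y∈D
        with s , m ← meet t v∈ y∈ with s∈D ← proj₁ (satD y∈ m) y∈D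
        with x≼s , x<s ← above-meet x∈ x≼y m (λ m′ → C∩D (proj₁ (satC x∈ m′) x∈C) s∈D) =
        cross₁₂ (C.restrict⁺ x∈C v∈C (≼-trans x≼s (≼ˡ m)) , s , ≼c (≼ˡ m) s∈D ,
                 D.restrict⁺ s∈D y∈D (≼ʳ m) , x<s)
      to x≼y | inj₂ (x∈ , y∈) | inj₂ x∈D | inj₁ y∈C
        with s , m ← meet t v∈ y∈ with s∈C ← proj₁ (satC y∈ m) y∈C
        with x≼s , x<s ← above-meet x∈ x≼y m (λ m′ → C∩D s∈C (proj₁ (satD x∈ m′) x∈D)) =
        cross₂₁ (≼c (≼-trans x≼s (≼ˡ m)) x∈D , s , C.restrict⁺ s∈C v∈C (≼ˡ m) ,
                 C.restrict⁺ s∈C y∈C (≼ʳ m) , x<s)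

      from : ∀ {x y} → Below x y → T ⊢ x ≼ y
      from (in₁ p) = C.restrict⁻ p
      from (in₂ p) = D.restrict⁻ p
      from (cross₁₂ (x≼v , z , z≼c , z≼y , x<z)) = ≼-trans
        (t.≼-below (C.restrict⁻ x≼v) (≼-trans (D.restrict⁻ z≼c) c≼v) (ℕ.<⇒≤ x<z)) (D.restrict⁻ z≼y)
      from (cross₂₁ (x≼c , z , z≼v , z≼y , x<z)) = ≼-trans
        (t.≼-below (≼-trans (D.restrict⁻ x≼c) c≼v) (C.restrict⁻ z≼v) (ℕ.<⇒≤ x<z)) (C.restrict⁻ z≼y)

    -- If `x` above `y` lies on the other side, saturation puts the component root `s` of `y` on the
    -- side of `y`. By `above-meet` the vertex `x` is then on the chain above `s`, which is exactly
    -- a crossing with `z` = `s`. Taking `c` largest puts every vertex of `D` on the chain of `v`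
    -- above `c`.
    spl-restrict : spl (restrict T C) v (restrict T D) c ≡ T
    spl-restrict = tree-ext spl-isTree t
      (⊆-antisym (λ x∈ → [ C⊆ , D⊆ ]′ (x∈p∪q⁻ C D x∈)) (λ x∈ → x∈p∪q⁺ (cover x∈)))
      (from ∘ ≼⇒below) (below⇒≼ ∘ to)

  restrict-good : ∀ {T v w C} → Good T → v ∈ vertices T → C ⊆ vertices T → Saturated T v C →
    T ⊢ w ≼ v → w ∈ C → (∀ {x} → x ∈ C → M x ∈ C) → (∀ {x} → M x ∈ C → x ∈ C) → Good (restrict T C)
  restrict-good {C = C} g v∈ C⊆ sat w≼v w∈ M∈C M∈C⁻ = record
    { isTree = restrict-isTree v∈ C⊆ sat w≼v w∈ ; M∈ = M∈C ; M∈⁻ = M∈C⁻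
    ; ≼M = λ x∈ → restrict⁺ x∈ (M∈C x∈) (Good.≼M g (C⊆ x∈)) }
    where open Restrict (Good.isTree g) C

  record Unspliced (T : RawTree r) (v x : Fin r) : Set where
    field
      {T₁ T₂}    : RawTree r
      {c}        : Fin r
      spliceable : Spliceable T₁ v T₂ c
      spliced    : spl T₁ v T₂ c ≡ T
      x∈         : x ∈ vertices T₂

  -- `T` is cut into the class `C` of `v` and its complement `D`. The fixed point `x` is not linked
  -- to `v`, so `D` meets the chain of `v`, and `c` is the last vertex of `D` there.
  unsplice : ∀ {T v x} → Good T → v ∈ vertices T → M v ≡ v →
             T ⊢ x ≼ v → x ≢ v → IsMeet T v (M x) x → Unspliced T v x
  unsplice {T} {v} {x} g v∈ Mv≡v x≼v x≢v x-fixed =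
    let c , c∈ , max = largest (chain T v ∩ D) (x , x∈p∩q⁺ (≼⇒∈chain isTree x≼v , x∈D))
        c∈v , c∈D    = x∈p∩q⁻ (chain T v) D c∈
        c≼v          = ∈chain⇒≼ c∈v
    in record
      { spliceable = record
        { good₁ = restrict-good g v∈ C⊆ satC here v∈C
                    (C⁺ ∘ linked-M ∘ C⁻) (C⁺ ∘ linked-M⁻ ∘ C⁻)
        ; good₂ = restrict-good g v∈ D⊆ satD x≼v x∈D
                    (λ y∈ → D⁺ (M∈ (D⊆ y∈)) (proj₂ (D⁻ y∈) ∘ linked-M⁻))
                    (λ y∈ → D⁺ (M∈⁻ (D⊆ y∈)) (proj₂ (D⁻ y∈) ∘ linked-M))
        ; disjoint = C∩D
        ; v∈ = v∈C
        ; c∈ = c∈D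
        ; c<v = Fin.≤∧≢⇒< (≼⇒≤ c≼v) λ c≡v → C∩D v∈C (subst (_∈ D) c≡v c∈D)
        ; connected = con }
      ; spliced = spl-restrict isTree v∈ C⊆ D⊆ cover C∩D satC satD v∈C c≼v c∈D
                    λ y≼v y∈ → max (x∈p∩q⁺ (≼⇒∈chain isTree y≼v , y∈))
      ; x∈ = x∈D }
    where
    open Good g
    open Class g v∈ Mv≡v
    D? : ∀ y → Dec (y ∈ vertices T × ¬ Linked y)
    D? y = (y ∈? vertices T) ×-dec ¬? (linked? y)
    C D : Subset r
    C = comprehension linked?
    D = comprehension D?
    open Restrict isTree C using (restrict⁻; restrict⁺; restrict-isTree)
    C⁺ : ∀ {y} → Linked y → y ∈ C
    C⁺ = ∈comprehension⁺ linked?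
    C⁻ : ∀ {y} → y ∈ C → Linked y
    C⁻ = ∈comprehension⁻ linked?
    D⁻ : ∀ {y} → y ∈ D → y ∈ vertices T × ¬ Linked y
    D⁻ = ∈comprehension⁻ D?
    D⁺ : ∀ {y} → y ∈ vertices T → ¬ Linked y → y ∈ D
    D⁺ y∈ ¬l = ∈comprehension⁺ D? (y∈ , ¬l)
    x∈D : x ∈ D
    x∈D = D⁺ (≼-source x≼v v∈) (fixed-unlinked x-fixed x≢v)
    v∈C : v ∈ C
    v∈C = C⁺ top
    C⊆ : C ⊆ vertices T
    C⊆ = linked∈ ∘ C⁻
    D⊆ : D ⊆ vertices T
    D⊆ = proj₁ ∘ D⁻
    C∩D : ∀ {y} → y ∈ C → y ∈ D → ⊥
    C∩D y∈C y∈D = proj₂ (D⁻ y∈D) (C⁻ y∈C)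
    cover : ∀ {y} → y ∈ vertices T → y ∈ C ⊎ y ∈ D
    cover {y} y∈ with linked? y
    ... | yes l = inj₁ (C⁺ l)
    ... | no ¬l = inj₂ (D⁺ y∈ ¬l)
    satC : Saturated T v C
    satC y∈ m = let ⇒ , ⇐ = linked-meet y∈ m in C⁺ ∘ ⇒ ∘ C⁻ , C⁺ ∘ ⇐ ∘ C⁻
    satD : Saturated T v D
    satD y∈ m = let ⇒ , ⇐ = linked-meet y∈ m in
      (λ y∈D → D⁺ (≼-source (≼ʳ m) y∈) (proj₂ (D⁻ y∈D) ∘ ⇐)) , (λ t∈D → D⁺ y∈ (proj₂ (D⁻ t∈D) ∘ ⇒))
    con : Connected (restrict T C) v
    con {y} y≼v y≢v with y∈C ← IsTree.≼-source (restrict-isTree v∈ C⊆ satC here v∈C) y≼v v∈C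
      with w , l , w≼v , w≼My , y<w ← linked-connected (C⁻ y∈C) (restrict⁻ y≼v) y≢v =
      w , restrict⁺ (C⁺ l) v∈C w≼v , restrict⁺ (C⁺ l) (C⁺ (linked-M (C⁻ y∈C))) w≼My , y<w

  -- At the meet x of v and u the block of x continues towards u, hence x is
  -- not linked to v.
  module _ {T : RawTree r} {v u x : Fin r} (g : Good T) (con : Connected T u)
           (x-meet : IsMeet T v u x) (x≢u : x ≢ u) where
    open Good g

    private
      w : ∃[ w ] T ⊢ w ≼ u × T ⊢ w ≼ M x × x < w
      w = con (≼ʳ x-meet) x≢u

    meet-fixed : x ∈ vertices T → IsMeet T v (M x) x
    meet-fixed x∈ with w , w≼u , w≼Mx , x<w ← w = isMeet (≼ˡ x-meet) (≼M x∈) λ {z} z≼v z≼Mx →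
      case ≼-comparable z≼Mx w≼Mx of λ
        { (inj₁ z≼w) → greatest x-meet z≼v (≼-trans z≼w w≼u)
        ; (inj₂ w≼z) → contradiction (≼⇒≤ (greatest x-meet (≼-trans w≼z z≼v) w≼u)) (ℕ.<⇒≱ x<w) }

    meet≢ : M v ≡ v → x ≢ v
    meet≢ Mv≡v refl with w , w≼u , w≼Mx , x<w ← w =
      contradiction (≼⇒≤ (subst (T ⊢ w ≼_) Mv≡v w≼Mx)) (ℕ.<⇒≱ x<w)

  module _ {T₁ T₂ v c u x} (s : Spliceable T₁ v T₂ c) (con : Connected (spl T₁ v T₂ c) u)
           (u∈ : u ∈ vertices (spl T₁ v T₂ c))
           (x-meet : IsMeet (spl T₁ v T₂ c) v u x) (x∈ : x ∈ vertices T₂) where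
    open Spliceable s
    private
      module S = Good spl-good

    meet-side : u ∈ vertices T₂
    meet-side = proj₂ (V₂-saturated u∈ x-meet) x∈

    -- A witness in the splice need not lie in `T₂`, but the lowest possible one does: the meet `w′`
    -- of `u` and `M y`.
    remainder-connected : Connected T₂ u
    remainder-connected {y} y≼u y≢u
      with y∈ ← g₂.≼-source y≼u meet-side
      with My∈ ← g₂.M∈ y∈
      with w , w≼u , w≼My , y<w ← con (below⇒≼ (in₂ y≼u)) y≢u
      with w′ , m ← meet spl-isTree u∈ (V₂⊆ My∈) =
      w′ , restrict₂ w′∈ meet-side (≼ˡ m) , restrict₂ w′∈ My∈ (≼ʳ m) ,
      ℕ.<-≤-trans y<w (S.≼⇒≤ (greatest m w≼u w≼My))
      where
      w′∈ : w′ ∈ vertices T₂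
      -- If `w′` is below `x`, its component root is `x`, which is in `T₂`. If it is strictly above
      -- `x`, it is the component root of `M y`, which is in `T₂`.
      w′∈ with w′ Fin.≟ x | ≼-comparable (≼ʳ x-meet) (≼ˡ m)
      ... | yes refl | _ = x∈
      ... | no _ | inj₁ x≼w′ = proj₂ (V₂-saturated (S.≼-source (≼ˡ m) u∈)
              (isMeet (≼ˡ x-meet) x≼w′ λ z≼v z≼w′ → greatest x-meet z≼v (≼-trans z≼w′ (≼ˡ m)))) x∈
      ... | no w′≢x | inj₂ w′≼x = proj₁ (V₂-saturated (V₂⊆ My∈)
              (isMeet (≼-trans w′≼x (≼ˡ x-meet)) (≼ʳ m) λ {z} z≼v z≼My →
                case ≼-comparable z≼v (≼ˡ x-meet) of λ
                  { (inj₁ z≼x) → greatest m (≼-trans z≼x (≼ʳ x-meet)) z≼My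
                  ; (inj₂ x≼z) → contradiction
                      (S.≼-antisym w′≼x (greatest m (≼ʳ x-meet) (≼-trans x≼z z≼My))) w′≢x })) My∈

-- The steps of the construction

module States {r : ℕ} (M : Fin r → Fin r) (M-idem : ∀ x → M (M x) ≡ M x)
              (o : Fin r) (Mo≡o : M o ≡ o) (o≤ : ∀ (x : Fin r) → o ≤ x) where
  open IsMeet
  open Blocks M M-idem

  -- The smallest element `o` is the root of its tree, and as `M o ≡ o` it is a fixed point; so it
  -- is never linked to `v`.
  unsplice-root : ∀ {T v} → Good T → v ∈ vertices T → M v ≡ v →
                  o ∈ vertices T → o ≢ v → Unspliced T v o
  unsplice-root {T} {v} g v∈ Mv≡v o∈ o≢v =
    unsplice g v∈ Mv≡v o≼v o≢v (subst (λ u → IsMeet T v u o) (sym Mo≡o) (meet-≼ o≼v))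
    where
    open Good g
    o≼v : T ⊢ o ≼ v
    o≼v = subst (T ⊢_≼ v) (Fin.≤-antisym (≼⇒≤ (root≼ o∈)) (o≤ root)) (root≼ v∈)

  -- Here the fixed point is the meet of `v` and `u`. It stays in the remainder, and `u` stays with
  -- it because `u` belongs to its component.
  unsplice-other : ∀ {T v u} → Good T → v ∈ vertices T → u ∈ vertices T → M v ≡ v → v < u →
    Connected T u → Σ[ U ∈ Unspliced T v u ] Connected (Unspliced.T₂ U) u
  unsplice-other {T} {v} {u} g v∈ u∈ Mv≡v v<u con
    with x , m ← meet (Good.isTree g) v∈ u∈ =
    relocate (unsplice g v∈ Mv≡v (≼ˡ m) (meet≢ g con m x≢u Mv≡v)
                       (meet-fixed g con m x≢u (Good.≼-source g (≼ˡ m) v∈))) u∈ con m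
    where
    x≢u : x ≢ u
    x≢u refl = ℕ.<⇒≱ v<u (Good.≼⇒≤ g (≼ˡ m))
    relocate : ∀ {T v u x} → Unspliced T v x → u ∈ vertices T → Connected T u → IsMeet T v u x →
               Σ[ U ∈ Unspliced T v u ] Connected (Unspliced.T₂ U) u
    relocate record { spliceable = s ; spliced = refl ; x∈ = x∈ } u∈ con m =
      record { spliceable = s ; spliced = refl ; x∈ = meet-side s con u∈ m x∈ } ,
      remainder-connected s con u∈ m x∈

  -- `μs` is an end segment (μᵢ,...,μₖ) of the list of block maxima: by `complete` all remaining
  -- maxima are smaller than μᵢ.
  record Maxima {n} (μs : Vec (Fin r) (suc n)) : Set where
    field
      fixed    : ∀ j → M (lookup μs j) ≡ lookup μs j
      mono     : ∀ {j k} → j < k → lookup μs j < lookup μs k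
      o<       : o < lookup μs zero
      complete : ∀ x → M x < lookup μs zero ⊎ ∃[ j ] M x ≡ lookup μs j

  open Maxima

  tail-maxima : ∀ {n μ} {μs : Vec (Fin r) (suc n)} → Maxima (μ ∷ μs) → Maxima μs
  tail-maxima {μ = μ} {μs} mx = record
    { fixed = fixed mx ∘ suc ; mono = mono mx ∘ s≤s ; o< = ℕ.<-trans (o< mx) μ<
    ; complete = λ x → case complete mx x of λ
        { (inj₁ lt) → inj₁ (ℕ.<-trans lt μ<)
        ; (inj₂ (zero , e)) → inj₁ (subst (_< lookup μs zero) (sym e) μ<)
        ; (inj₂ (suc j , e)) → inj₂ (j , e) } }
    where
    μ< : μ < lookup μs zero
    μ< = mono mx {zero} {suc zero} (s≤s z≤n)

  maxima-gap : ∀ {n μ} {μs : Vec (Fin r) (suc n)} → Maxima (μ ∷ μs) →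
               ∀ {x} → M x < lookup μs zero → M x ≡ μ ⊎ M x < μ
  maxima-gap mx {x} lt with complete mx x
  ... | inj₁ lt′         = inj₂ lt′
  ... | inj₂ (zero  , e) = inj₁ e
  ... | inj₂ (suc zero , e) = contradiction (subst (_< _) e lt) (ℕ.<-irrefl refl)
  ... | inj₂ (suc (suc j) , e) =
    contradiction (mono mx {suc zero} {suc (suc j)} (s≤s (s≤s z≤n))) (ℕ.<-asym (subst (_< _) e lt))

  -- The situation (τ₁, ν, τᵢ, …, τₖ) at the beginning of the step with index i:
  -- in τⱼ the block of μⱼ has absorbed only blocks with index smaller than i.
  record Valid {n} (τ₁ : RawTree r) (ν : Fin r) (μs : Vec (Fin r) (suc n))
               (τs : Vec (RawTree r) (suc n)) : Set where
    V : Fin (2 ℕ.+ n) → Subset r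
    V j = vertices (lookup (τ₁ ∷ τs) j)
    field
      good      : ∀ j → Good (lookup (τ₁ ∷ τs) j)
      disjoint  : ∀ {j k x} → x ∈ V j → x ∈ V k → j ≡ k
      cover     : ∀ x → ∃[ j ] x ∈ V j
      o∈        : o ∈ V zero
      ν∈        : ν ∈ V zero
      μ∈        : ∀ j → lookup μs j ∈ V (suc j)
      connected : ∀ j → Connected (lookup τs j) (lookup μs j)
      low₁      : ∀ {x} → x ∈ V zero → M x < lookup μs zero
      low       : ∀ j {x} → x ∈ V (suc j) → M x ≡ lookup μs j ⊎ M x < lookup μs zero

    x≤Mx : ∀ {j x} → x ∈ V j → x ≤ M x
    x≤Mx {j} x∈ = Good.≼⇒≤ (good j) (Good.≼M (good j) x∈)

    root-spliceable : Spliceable (lookup τs zero) (lookup μs zero) τ₁ ν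
    root-spliceable = record
      { good₁ = good (suc zero) ; good₂ = good zero
      ; disjoint = λ x∈ x∈₁ → case disjoint {suc zero} {zero} x∈ x∈₁ of λ ()
      ; v∈ = μ∈ zero ; c∈ = ν∈
      ; c<v = ℕ.≤-<-trans (x≤Mx {zero} ν∈) (low₁ ν∈) ; connected = connected zero }

  -- A named counterpart of the function local to `run`; `run-other` identifies the two.
  attach : RawTree r → Fin r → Fin r → RawTree r → RawTree r
  attach τᵢ μᵢ c τⱼ = if does (c ∈? vertices τⱼ) then spl τᵢ μᵢ τⱼ c else τⱼ

  attach-in : ∀ {τ μ c T} → c ∈ vertices T → attach τ μ c T ≡ spl τ μ T c
  attach-in {c = c} {T} c∈ rewrite dec-true (c ∈? vertices T) c∈ = refl

  attach-out : ∀ {τ μ c T} → c ∉ vertices T → attach τ μ c T ≡ T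
  attach-out {c = c} {T} c∉ rewrite dec-false (c ∈? vertices T) c∉ = refl

  module _ {n} {τ₁ : RawTree r} {ν c : Fin r} {cs : Vec (Fin r) n} {μ : Fin r}
           {μs : Vec (Fin r) (suc n)} {τ : RawTree r} {τs : Vec (RawTree r) (suc n)} where

    run-root : c ∈ vertices τ₁ ⊎ c ∈ vertices τ →
      run τ₁ ν (c ∷ cs) (μ ∷ μs) (τ ∷ τs) ≡ run (spl τ μ τ₁ ν) c cs μs τs
    run-root c∈ rewrite dec-true (c ∈? vertices τ₁ ⊎-dec c ∈? vertices τ) c∈ = refl

    run-other : ¬ (c ∈ vertices τ₁ ⊎ c ∈ vertices τ) →
      run τ₁ ν (c ∷ cs) (μ ∷ μs) (τ ∷ τs) ≡ run τ₁ ν cs μs (Vec.map (attach τ μ c) τs)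
    run-other c∉ rewrite dec-false (c ∈? vertices τ₁ ⊎-dec c ∈? vertices τ) c∉ =
      cong (run τ₁ ν cs μs) (map-cong (λ _ → refl) τs)

  module _ {n} {τ₁ : RawTree r} {ν : Fin r} {μ} {μs : Vec (Fin r) (suc n)}
           {τ} {τs : Vec (RawTree r) (suc n)}
           (mx : Maxima (μ ∷ μs)) (va : Valid τ₁ ν (μ ∷ μs) (τ ∷ τs)) where
    open Valid va
    private
      μ< : μ < lookup μs zero
      μ< = mono mx {zero} {suc zero} (s≤s z≤n)

      low-τ : ∀ {x} → x ∈ vertices τ → M x < lookup μs zero
      low-τ x∈ with low zero x∈
      ... | inj₁ e  = subst (_< lookup μs zero) (sym e) μ<
      ... | inj₂ lt = ℕ.<-trans lt μ<

      low-τs : ∀ j {x} → x ∈ vertices (lookup τs j) → M x ≡ lookup μs j ⊎ M x < lookup μs zero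
      low-τs j x∈ with low (suc j) x∈
      ... | inj₁ e  = inj₁ e
      ... | inj₂ lt = inj₂ (ℕ.<-trans lt μ<)

    valid-root : ∀ {c} → c ∈ vertices τ₁ ⊎ c ∈ vertices τ → Valid (spl τ μ τ₁ ν) c μs τs
    valid-root c∈ = record
      { good = λ { zero → spl-good ; (suc j) → good (suc (suc j)) }
      ; disjoint = disjoint′
      ; cover = λ x → case cover x of λ
          { (zero , x∈) → zero , V₂⊆ x∈ ; (suc zero , x∈) → zero , V₁⊆ x∈
          ; (suc (suc j) , x∈) → suc j , x∈ }
      ; o∈ = V₂⊆ o∈ ; ν∈ = [ V₂⊆ , V₁⊆ ]′ c∈
      ; μ∈ = μ∈ ∘ suc ; connected = connected ∘ suc
      ; low₁ = λ x∈ → case V⁻ x∈ of λ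
          { (inj₁ x∈τ) → low-τ x∈τ ; (inj₂ x∈₁) → ℕ.<-trans (low₁ x∈₁) μ< }
      ; low = low-τs }
      where
      open Spliceable root-spliceable hiding (disjoint; connected; c∈)
      disjoint′ : ∀ {j k x} → x ∈ vertices (lookup (spl τ μ τ₁ ν ∷ τs) j) →
                  x ∈ vertices (lookup (spl τ μ τ₁ ν ∷ τs) k) → j ≡ k
      disjoint′ {zero}  {zero}  _ _ = refl
      disjoint′ {suc j} {suc k} p q with refl ← disjoint {suc (suc j)} {suc (suc k)} p q = refl
      disjoint′ {zero}  {suc k} p q with V⁻ p
      ... | inj₁ p′ with () ← disjoint {suc zero} {suc (suc k)} p′ q
      ... | inj₂ p′ with () ← disjoint {zero} {suc (suc k)} p′ q
      disjoint′ {suc j} {zero} p q with V⁻ q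
      ... | inj₁ q′ with () ← disjoint {suc (suc j)} {suc zero} p q′
      ... | inj₂ q′ with () ← disjoint {suc (suc j)} {zero} p q′

    other-index : ∀ {c} → ¬ (c ∈ vertices τ₁ ⊎ c ∈ vertices τ) → ∃[ j ] c ∈ vertices (lookup τs j)
    other-index {c} c∉ with cover c
    ... | zero , c∈ = contradiction (inj₁ c∈) c∉
    ... | suc zero , c∈ = contradiction (inj₂ c∈) c∉
    ... | suc (suc j) , c∈ = j , c∈

    module _ {c j} (c≤μ : c ≤ μ) (c∈ : c ∈ vertices (lookup τs j)) where

      other-spliceable : Spliceable τ μ (lookup τs j) c
      other-spliceable = record
        { good₁ = good (suc zero) ; good₂ = good (suc (suc j))
        ; disjoint = λ x∈ x∈₁ → case disjoint {suc zero} {suc (suc j)} x∈ x∈₁ of λ ()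
        ; v∈ = μ∈ zero ; c∈ = c∈
        -- Equality is excluded because `μ` is a vertex of τᵢ and `c` is one of τⱼ.
        ; c<v = Fin.≤∧≢⇒< c≤μ λ { refl →
            case disjoint {suc zero} {suc (suc j)} (μ∈ zero) c∈ of λ () }
        ; connected = connected zero }

      attached-at : lookup (Vec.map (attach τ μ c) τs) j ≡ spl τ μ (lookup τs j) c
      attached-at = trans (lookup-map j (attach τ μ c) τs) (attach-in c∈)

      attached-off : ∀ {k} → k ≢ j → lookup (Vec.map (attach τ μ c) τs) k ≡ lookup τs k
      attached-off {k} k≢j = trans (lookup-map k (attach τ μ c) τs)
        (attach-out λ c∈k → k≢j (Fin.suc-injective (Fin.suc-injective
          (disjoint {suc (suc k)} {suc (suc j)} c∈k c∈))))

      valid-other : Valid τ₁ ν μs (Vec.map (attach τ μ c) τs)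
      valid-other = record
        { good = λ { zero → good zero ; (suc k) → good′ k }
        ; disjoint = disjoint′
        ; cover = λ x → case cover x of λ
            { (zero , x∈) → zero , x∈
            ; (suc zero , x∈) → suc j , subst (λ T → x ∈ vertices T) (sym attached-at) (V₁⊆ x∈)
            ; (suc (suc k) , x∈) → suc k , grow k x∈ }
        ; o∈ = o∈ ; ν∈ = ν∈
        ; μ∈ = λ k → grow k (μ∈ (suc k))
        ; connected = connected′
        ; low₁ = λ x∈ → ℕ.<-trans (low₁ x∈) μ<
        ; low = λ k x∈ → case shrink k x∈ of λ
            { (inj₁ x∈k) → low-τs k x∈k ; (inj₂ (x∈τ , _)) → inj₂ (low-τ x∈τ) } }
        where
        open Spliceable other-spliceable hiding (disjoint; connected; c∈)
        τs′ : Vec (RawTree r) (suc n)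
        τs′ = Vec.map (attach τ μ c) τs
        good′ : ∀ k → Good (lookup τs′ k)
        good′ k with k Fin.≟ j
        ... | yes refl = subst Good (sym attached-at) spl-good
        ... | no k≢j   = subst Good (sym (attached-off k≢j)) (good (suc (suc k)))
        connected′ : ∀ k → Connected (lookup τs′ k) (lookup μs k)
        connected′ k with k Fin.≟ j
        ... | yes refl = subst (λ T → Connected T (lookup μs j)) (sym attached-at)
                           (spl-connected (μ∈ (suc j)) (connected (suc j)))
        ... | no k≢j   = subst (λ T → Connected T (lookup μs k)) (sym (attached-off k≢j))
                           (connected (suc k))
        grow : ∀ k {x} → x ∈ vertices (lookup τs k) → x ∈ vertices (lookup τs′ k)
        grow k {x} x∈ with k Fin.≟ j
        ... | yes refl = subst (λ T → x ∈ vertices T) (sym attached-at) (V₂⊆ x∈)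
        ... | no k≢j   = subst (λ T → x ∈ vertices T) (sym (attached-off k≢j)) x∈
        shrink : ∀ k {x} → x ∈ vertices (lookup τs′ k) →
                 x ∈ vertices (lookup τs k) ⊎ x ∈ vertices τ × k ≡ j
        shrink k {x} x∈ with k Fin.≟ j
        ... | no k≢j   = inj₁ (subst (λ T → x ∈ vertices T) (attached-off k≢j) x∈)
        ... | yes refl with V⁻ (subst (λ T → x ∈ vertices T) attached-at x∈)
        ...   | inj₁ x∈τ = inj₂ (x∈τ , refl)
        ...   | inj₂ x∈j = inj₁ x∈j
        disjoint′ : ∀ {k l x} → x ∈ vertices (lookup (τ₁ ∷ τs′) k) →
                    x ∈ vertices (lookup (τ₁ ∷ τs′) l) → k ≡ l
        disjoint′ {zero}  {zero}  _ _ = refl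
        disjoint′ {zero}  {suc l} p q with shrink l q
        ... | inj₁ q′ with () ← disjoint {zero} {suc (suc l)} p q′
        ... | inj₂ (q′ , _) with () ← disjoint {zero} {suc zero} p q′
        disjoint′ {suc k} {zero} p q with shrink k p
        ... | inj₁ p′ with () ← disjoint {suc (suc k)} {zero} p′ q
        ... | inj₂ (p′ , _) with () ← disjoint {suc zero} {zero} p′ q
        disjoint′ {suc k} {suc l} p q with shrink k p | shrink l q
        ... | inj₁ p′ | inj₁ q′ = cong suc (Fin.suc-injective (Fin.suc-injective
                                    (disjoint {suc (suc k)} {suc (suc l)} p′ q′)))
        ... | inj₁ p′ | inj₂ (q′ , _) with () ← disjoint {suc (suc k)} {suc zero} p′ q′
        ... | inj₂ (p′ , _) | inj₁ q′ with () ← disjoint {suc zero} {suc (suc l)} p′ q′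
        ... | inj₂ (_ , refl) | inj₂ (_ , refl) = refl

  -- The resulting tree and injectivity

  Bounded : ∀ {n} → Vec (Fin r) n → Vec (Fin r) (suc n) → Set
  Bounded cs μs = ∀ i → lookup cs i ≤ lookup μs (inject₁ i)

  run-good : ∀ {n τ₁ ν} (cs : Vec (Fin r) n) {μs τs} → Maxima μs →
             Valid τ₁ ν μs τs → Bounded cs μs →
             Good (run τ₁ ν cs μs τs) × vertices (run τ₁ ν cs μs τs) ≡ ⊤
  run-good [] {μ ∷ []} {τ ∷ []} mx va bd = spl-good ,
    ⊆-antisym (λ _ → ∈⊤) (λ {x} _ → case cover x of λ
      { (zero , x∈) → V₂⊆ x∈ ; (suc zero , x∈) → V₁⊆ x∈ })
    where
    open Valid va using (cover; root-spliceable)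
    open Spliceable root-spliceable
  run-good {τ₁ = τ₁} {ν} (c ∷ cs) {μ ∷ μs} {τ ∷ τs} mx va bd
    with c ∈? vertices τ₁ ⊎-dec c ∈? vertices τ
  ... | yes c∈ = subst (λ T → Good T × vertices T ≡ ⊤) (sym (run-root {cs = cs} {τs = τs} c∈))
        (run-good cs (tail-maxima mx) (valid-root mx va c∈) (bd ∘ suc))
  ... | no c∉ with j , c∈ ← other-index mx va c∉ =
        subst (λ T → Good T × vertices T ≡ ⊤) (sym (run-other {cs = cs} {τs = τs} c∉))
        (run-good cs (tail-maxima mx) (valid-other mx va (bd zero) c∈) (bd ∘ suc))

  module _ {n} {τ₁ τ₁′ : RawTree r} {ν ν′ c c′ μ : Fin r} {μs : Vec (Fin r) (suc n)}
           {τ τ′ τs τs′ j j′}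
           (mx : Maxima (μ ∷ μs)) (va : Valid τ₁ ν (μ ∷ μs) (τ ∷ τs))
           (va′ : Valid τ₁′ ν′ (μ ∷ μs) (τ′ ∷ τs′))
           (c≤μ : c ≤ μ) (c′≤μ : c′ ≤ μ)
           (c∈ : c ∈ vertices (lookup τs j)) (c′∈ : c′ ∈ vertices (lookup τs′ j′))
           (eqs : Vec.map (attach τ μ c) τs ≡ Vec.map (attach τ′ μ c′) τs′) where

    -- After the step `μ` lies in the tree that was changed and in no other, so it tells which one
    -- this was.
    same-index : j ≡ j′
    same-index = Fin.suc-injective (Valid.disjoint (valid-other mx va c≤μ c∈) {suc j} {suc j′}
      (subst (λ T → μ ∈ vertices T) (sym (attached-at mx va c≤μ c∈))
        (Spliceable.V₁⊆ (other-spliceable mx va c≤μ c∈) (Valid.μ∈ va zero)))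
      (subst (λ σs → μ ∈ vertices (lookup σs j′)) (sym eqs)
        (subst (λ T → μ ∈ vertices T) (sym (attached-at mx va′ c′≤μ c′∈))
          (Spliceable.V₁⊆ (other-spliceable mx va′ c′≤μ c′∈) (Valid.μ∈ va′ zero)))))

    same-splice : j ≡ j′ → τ ≡ τ′ × lookup τs j ≡ lookup τs′ j′ × c ≡ c′
    same-splice refl = spl-injective
      (other-spliceable mx va c≤μ c∈) (other-spliceable mx va′ c′≤μ c′∈)
      (trans (sym (attached-at mx va c≤μ c∈))
        (trans (cong (λ σs → lookup σs j) eqs) (attached-at mx va′ c′≤μ c′∈)))

  -- Strengthened to recover the whole starting situation: the induction hypothesis then yields the
  -- trees and ν right after the first step, and `spl-injective` undoes this step.
  run-injective : ∀ {n τ₁ τ₁′ ν ν′} (cs cs′ : Vec (Fin r) n) {μs τs τs′} → Maxima μs →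
    Valid τ₁ ν μs τs → Valid τ₁′ ν′ μs τs′ → Bounded cs μs → Bounded cs′ μs →
    run τ₁ ν cs μs τs ≡ run τ₁′ ν′ cs′ μs τs′ → τ₁ ≡ τ₁′ × ν ≡ ν′ × τs ≡ τs′ × cs ≡ cs′
  run-injective [] [] {μ ∷ []} {τ ∷ []} {τ′ ∷ []} mx va va′ bd bd′ eq
    with refl , refl , refl ←
           spl-injective (Valid.root-spliceable va) (Valid.root-spliceable va′) eq =
    refl , refl , refl , refl
  run-injective {τ₁ = τ₁} {τ₁′} (c ∷ cs) (c′ ∷ cs′) {μ ∷ μs} {τ ∷ τs} {τ′ ∷ τs′} mx va va′ bd bd′ eq
    with c ∈? vertices τ₁ ⊎-dec c ∈? vertices τ | c′ ∈? vertices τ₁′ ⊎-dec c′ ∈? vertices τ′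
  ... | yes c∈ | yes c′∈
    with eq₁ , refl , refl , refl ← run-injective cs cs′ (tail-maxima mx)
           (valid-root mx va c∈) (valid-root mx va′ c′∈) (bd ∘ suc) (bd′ ∘ suc)
           (trans (sym (run-root {cs = cs} {τs = τs} c∈))
             (trans eq (run-root {cs = cs′} {τs = τs′} c′∈)))
    with refl , refl , refl ←
           spl-injective (Valid.root-spliceable va) (Valid.root-spliceable va′) eq₁ =
    refl , refl , refl , refl
  ... | yes c∈ | no c′∉ with j′ , c′∈ ← other-index mx va′ c′∉
    with refl , _ ← run-injective cs cs′ (tail-maxima mx)
           (valid-root mx va c∈) (valid-other mx va′ (bd′ zero) c′∈) (bd ∘ suc) (bd′ ∘ suc)
           (trans (sym (run-root {cs = cs} {τs = τs} c∈))
             (trans eq (run-other {cs = cs′} {τs = τs′} c′∉)))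
    -- Both runs continue with the same τ₁. The first alternative has put `μ` into it, the second
    -- has left `μ` outside.
    with () ← Valid.disjoint va′ {zero} {suc zero}
                (Spliceable.V₁⊆ (Valid.root-spliceable va) (Valid.μ∈ va zero)) (Valid.μ∈ va′ zero)
  run-injective {τ₁ = τ₁} {τ₁′} (c ∷ cs) (c′ ∷ cs′) {μ ∷ μs} {τ ∷ τs} {τ′ ∷ τs′} mx va va′ bd bd′ eq
    | no c∉ | yes c′∈ with j , c∈ ← other-index mx va c∉
    with refl , _ ← run-injective cs cs′ (tail-maxima mx)
           (valid-other mx va (bd zero) c∈) (valid-root mx va′ c′∈) (bd ∘ suc) (bd′ ∘ suc)
           (trans (sym (run-other {cs = cs} {τs = τs} c∉))
             (trans eq (run-root {cs = cs′} {τs = τs′} c′∈)))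
    with () ← Valid.disjoint va {zero} {suc zero}
                (Spliceable.V₁⊆ (Valid.root-spliceable va′) (Valid.μ∈ va′ zero)) (Valid.μ∈ va zero)
  run-injective {τ₁ = τ₁} {τ₁′} (c ∷ cs) (c′ ∷ cs′) {μ ∷ μs} {τ ∷ τs} {τ′ ∷ τs′} mx va va′ bd bd′ eq
    | no c∉ | no c′∉ with j , c∈ ← other-index mx va c∉ | j′ , c′∈ ← other-index mx va′ c′∉
    with refl , refl , eqs , refl ← run-injective cs cs′ (tail-maxima mx)
           (valid-other mx va (bd zero) c∈) (valid-other mx va′ (bd′ zero) c′∈)
           (bd ∘ suc) (bd′ ∘ suc)
           (trans (sym (run-other {cs = cs} {τs = τs} c∉))
             (trans eq (run-other {cs = cs′} {τs = τs′} c′∉)))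
    with refl ← same-index mx va va′ (bd zero) (bd′ zero) c∈ c′∈ eqs
    with refl , eqⱼ , refl ← same-splice mx va va′ (bd zero) (bd′ zero) c∈ c′∈ eqs refl =
    refl , refl , cong (τ ∷_) (lookup-ext λ k → case k Fin.≟ j of λ
      { (yes refl) → eqⱼ
      ; (no k≢j) → trans (sym (attached-off mx va (bd zero) c∈ k≢j))
          (trans (cong (λ σs → lookup σs k) eqs) (attached-off mx va′ (bd′ zero) c′∈ k≢j)) }) , refl

  -- Undoing one step of the construction

  module _ {n} {τ₁ : RawTree r} {ν μ : Fin r} {μs : Vec (Fin r) (suc n)}
           {τs : Vec (RawTree r) (suc n)}
           (mx : Maxima (μ ∷ μs)) (va : Valid τ₁ ν μs τs) where
    open Valid va
    private
      low-gap : ∀ j {x} → x ∈ V (suc j) → M x ≢ μ → M x ≡ lookup μs j ⊎ M x < μ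
      low-gap j x∈ Mx≢μ with low j x∈
      ... | inj₁ e = inj₁ e
      ... | inj₂ lt with maxima-gap mx lt
      ...   | inj₁ e   = contradiction e Mx≢μ
      ...   | inj₂ lt′ = inj₂ lt′

      M≢μ-at : ∀ {j k} → μ ∈ V j → j ≢ k → ∀ {x} → x ∈ V k → M x ≢ μ
      M≢μ-at {j} {k} μ∈j j≢k x∈ refl = j≢k (disjoint {j} {k} μ∈j (Good.M∈ (good k) x∈))

    -- The recovered `c` is the value of ν before the step. The list entry of this step is the ν
    -- after it, see `extend`.
    back-root : μ ∈ vertices τ₁ → ∃[ σ₁ ] ∃[ σ ] ∃[ c ]
                Valid σ₁ c (μ ∷ μs) (σ ∷ τs) × spl σ μ σ₁ c ≡ τ₁
    back-root μ∈₁ with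
      record { T₁ = σ ; T₂ = σ₁ ; c = c ; spliceable = s ; spliced = refl ; x∈ = o∈₁ } ←
      unsplice-root (good zero) μ∈₁ (fixed mx zero) o∈ (Fin.<⇒≢ (o< mx)) = σ₁ , σ , c , record
      { good = λ { zero → s.good₂ ; (suc zero) → s.good₁ ; (suc (suc k)) → good (suc k) }
      ; disjoint = disjoint′
      ; cover = λ x → case cover x of λ
          { (zero , x∈) → [ (λ x∈σ → suc zero , x∈σ) , (λ x∈σ₁ → zero , x∈σ₁) ]′ (s.V⁻ x∈)
          ; (suc k , x∈) → suc (suc k) , x∈ }
      ; o∈ = o∈₁ ; ν∈ = s.c∈
      ; μ∈ = λ { zero → s.v∈ ; (suc k) → μ∈ k }
      ; connected = λ { zero → s.connected ; (suc k) → connected k }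
      ; low₁ = λ x∈ → case maxima-gap mx (low₁ (s.V₂⊆ x∈)) of λ
          { (inj₁ e) → ⊥-elim (s.disjoint s.v∈ (subst (_∈ vertices σ₁) e (s.g₂.M∈ x∈)))
          ; (inj₂ lt) → lt }
      ; low = λ { zero x∈ → maxima-gap mx (low₁ (s.V₁⊆ x∈))
                ; (suc k) x∈ → low-gap k x∈ (M≢μ-at {zero} {suc k} μ∈₁ (λ ()) x∈) } } , refl
      where
      module s = Spliceable s
      disjoint′ : ∀ {k l x} → x ∈ vertices (lookup (σ₁ ∷ σ ∷ τs) k) →
                  x ∈ vertices (lookup (σ₁ ∷ σ ∷ τs) l) → k ≡ l
      disjoint′ {zero} {zero} _ _ = refl
      disjoint′ {zero} {suc zero} p q = ⊥-elim (s.disjoint q p)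
      disjoint′ {zero} {suc (suc l)} p q with () ← disjoint {zero} {suc l} (s.V₂⊆ p) q
      disjoint′ {suc zero} {zero} p q = ⊥-elim (s.disjoint p q)
      disjoint′ {suc zero} {suc zero} _ _ = refl
      disjoint′ {suc zero} {suc (suc l)} p q with () ← disjoint {zero} {suc l} (s.V₁⊆ p) q
      disjoint′ {suc (suc k)} {zero} p q with () ← disjoint {suc k} {zero} p (s.V₂⊆ q)
      disjoint′ {suc (suc k)} {suc zero} p q with () ← disjoint {suc k} {zero} p (s.V₁⊆ q)
      disjoint′ {suc (suc k)} {suc (suc l)} p q = cong suc (disjoint {suc k} {suc l} p q)

    -- Only τⱼ is cut. Here the recovered `c` is the list entry of the step itself, and ν is
    -- unchanged.
    back-other : ∀ {j} → μ ∈ vertices (lookup τs j) → ∃[ σ ] ∃[ σs ] ∃[ c ]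
                 Valid τ₁ ν (μ ∷ μs) (σ ∷ σs) × c ∈ vertices (lookup σs j) × c ≤ μ ×
                 Vec.map (attach σ μ c) σs ≡ τs
    back-other {j} μ∈j
      with record { T₁ = σ ; T₂ = σⱼ ; c = c ; spliceable = s ; spliced = eq ; x∈ = μⱼ∈ } , con ←
        unsplice-other (good (suc j)) μ∈j (μ∈ j) (fixed mx zero)
          (mono mx {zero} {suc j} (s≤s z≤n)) (connected j) =
      σ , σs , c , va′ , c∈ , c≤μ , restored
      where
      module s = Spliceable s
      σs : Vec (RawTree r) (suc n)
      σs = τs [ j ]≔ σⱼ
      at : lookup σs j ≡ σⱼ
      at = lookup∘update j τs σⱼ
      off : ∀ {k} → k ≢ j → lookup σs k ≡ lookup τs k
      off k≢j = lookup∘update′ k≢j τs σⱼ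
      V₁⊆ : ∀ {x} → x ∈ vertices σ → x ∈ V (suc j)
      V₁⊆ {x} x∈ = subst (λ T → x ∈ vertices T) eq (s.V₁⊆ x∈)
      V₂⊆ : ∀ {x} → x ∈ vertices σⱼ → x ∈ V (suc j)
      V₂⊆ {x} x∈ = subst (λ T → x ∈ vertices T) eq (s.V₂⊆ x∈)
      V⁻ : ∀ {x} → x ∈ V (suc j) → x ∈ vertices σ ⊎ x ∈ vertices σⱼ
      V⁻ {x} x∈ = s.V⁻ (subst (λ T → x ∈ vertices T) (sym eq) x∈)
      M≢μ : ∀ {x} → x ∈ vertices σⱼ → M x ≢ μ
      M≢μ x∈ e = s.disjoint s.v∈ (subst (_∈ vertices σⱼ) e (s.g₂.M∈ x∈))
      replaced : ∀ {P : Fin (suc n) → RawTree r → Set} → P j σⱼ →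
                 (∀ {k} → k ≢ j → P k (lookup τs k)) →
                 ∀ k → P k (lookup σs k)
      replaced {P} pⱼ pₖ k with k Fin.≟ j
      ... | yes refl = subst (P j) (sym at) pⱼ
      ... | no k≢j   = subst (P k) (sym (off k≢j)) (pₖ k≢j)
      shrink : ∀ k {x} → x ∈ vertices (lookup σs k) → x ∈ V (suc k) × ¬ x ∈ vertices σ
      shrink = replaced {λ k T → ∀ {x} → x ∈ vertices T → x ∈ V (suc k) × ¬ x ∈ vertices σ}
        (λ x∈ → V₂⊆ x∈ , λ x∈σ → s.disjoint x∈σ x∈)
        (λ {k} k≢j x∈ → x∈ , λ x∈σ →
          k≢j (Fin.suc-injective (disjoint {suc k} {suc j} x∈ (V₁⊆ x∈σ))))
      disjoint′ : ∀ {k l x} → x ∈ vertices (lookup (τ₁ ∷ σ ∷ σs) k) →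
                  x ∈ vertices (lookup (τ₁ ∷ σ ∷ σs) l) → k ≡ l
      disjoint′ {zero} {zero} _ _ = refl
      disjoint′ {zero} {suc zero} p q with () ← disjoint {zero} {suc j} p (V₁⊆ q)
      disjoint′ {zero} {suc (suc l)} p q with () ← disjoint {zero} {suc l} p (proj₁ (shrink l q))
      disjoint′ {suc zero} {zero} p q with () ← disjoint {suc j} {zero} (V₁⊆ p) q
      disjoint′ {suc zero} {suc zero} _ _ = refl
      disjoint′ {suc zero} {suc (suc l)} p q = contradiction p (proj₂ (shrink l q))
      disjoint′ {suc (suc k)} {zero} p q with () ← disjoint {suc k} {zero} (proj₁ (shrink k p)) q
      disjoint′ {suc (suc k)} {suc zero} p q = contradiction q (proj₂ (shrink k p))
      disjoint′ {suc (suc k)} {suc (suc l)} p q =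
        cong suc (disjoint {suc k} {suc l} (proj₁ (shrink k p)) (proj₁ (shrink l q)))
      cover′ : ∀ x → ∃[ k ] x ∈ vertices (lookup (τ₁ ∷ σ ∷ σs) k)
      cover′ x with cover x
      ... | zero , x∈ = zero , x∈
      ... | suc k , x∈ with k Fin.≟ j
      ...   | no k≢j = suc (suc k) , subst (λ T → x ∈ vertices T) (sym (off k≢j)) x∈
      ...   | yes refl with V⁻ x∈
      ...     | inj₁ x∈σ = suc zero , x∈σ
      ...     | inj₂ x∈ⱼ = suc (suc j) , subst (λ T → x ∈ vertices T) (sym at) x∈ⱼ
      va′ : Valid τ₁ ν (μ ∷ μs) (σ ∷ σs)
      va′ = record
        { good = λ { zero → good zero ; (suc zero) → s.good₁
                   ; (suc (suc k)) → replaced {λ _ → Good} s.good₂ (λ {k} _ → good (suc k)) k }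
        ; disjoint = disjoint′
        ; cover = cover′
        ; o∈ = o∈ ; ν∈ = ν∈
        ; μ∈ = λ { zero → s.v∈
                 ; (suc k) → replaced {λ k T → lookup μs k ∈ vertices T} μⱼ∈ (λ {k} _ → μ∈ k) k }
        ; connected = λ { zero → s.connected
                        ; (suc k) → replaced {λ k T → Connected T (lookup μs k)} con
                                      (λ {k} _ → connected k) k }
        ; low₁ = λ x∈ → case maxima-gap mx (low₁ x∈) of λ
            { (inj₁ e) → contradiction e (M≢μ-at {suc j} {zero} μ∈j (λ ()) x∈)
            ; (inj₂ lt) → lt }
        ; low = λ
            -- A block with maximum μⱼ cannot lie in `σ`, because μⱼ remains in `σⱼ`.
            { zero x∈ → case low j (V₁⊆ x∈) of λ
              { (inj₁ e) → ⊥-elim (s.disjoint (s.g₁.M∈ x∈) (subst (_∈ vertices σⱼ) (sym e) μⱼ∈))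
              ; (inj₂ lt) → maxima-gap mx lt }
            ; (suc k) → replaced {λ k T → ∀ {x} → x ∈ vertices T → M x ≡ lookup μs k ⊎ M x < μ}
                (λ x∈ → low-gap j (V₂⊆ x∈) (M≢μ x∈))
                (λ {k} k≢j x∈ → low-gap k x∈
                  (M≢μ-at {suc j} {suc k} μ∈j (λ { refl → k≢j refl }) x∈)) k } }
      c∈ : c ∈ vertices (lookup σs j)
      c∈ = subst (λ T → c ∈ vertices T) (sym at) s.c∈
      c≤μ : c ≤ μ
      c≤μ = ℕ.<⇒≤ s.c<v
      restored : Vec.map (attach σ μ c) σs ≡ τs
      restored = lookup-ext λ k → case k Fin.≟ j of λ
        { (yes refl) → trans (attached-at mx va′ c≤μ c∈) (trans (cong (λ T → spl σ μ T c) at) eq)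
        ; (no k≢j) → trans (attached-off mx va′ c≤μ c∈ k≢j) (off k≢j) }

  -- Surjectivity: running the construction backwards

  record Preimage {n} (μs : Vec (Fin r) (suc n)) (T : RawTree r) : Set where
    field
      {τ₁}    : RawTree r
      {ν}     : Fin r
      {τs}    : Vec (RawTree r) (suc n)
      cs      : Vec (Fin r) n
      valid   : Valid τ₁ ν μs τs
      bounded : Bounded cs μs
      run≡    : run τ₁ ν cs μs τs ≡ T

  -- The tree that contains `μ` decides which of the two alternatives is undone.
  extend : ∀ {n μ} {μs : Vec (Fin r) (suc n)} {T} → Maxima (μ ∷ μs) →
           Preimage μs T → Preimage (μ ∷ μs) T
  extend {μ = μ} {μs} {T} mx p = choose (Valid.cover valid μ)
    where
    open Preimage p
    ν∈ : ν ∈ vertices τ₁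
    ν∈ = Valid.ν∈ valid
    -- In the first alternative ν becomes the list entry cᵢ, so the bound cᵢ ≤ μᵢ is required. It
    -- holds because all blocks in τ₁ have maxima at most μᵢ.
    ν≤μ : ν ≤ μ
    ν≤μ with maxima-gap mx (Valid.low₁ valid ν∈)
    ... | inj₁ e  = subst (ν ≤_) e (Valid.x≤Mx valid {zero} ν∈)
    ... | inj₂ lt = ℕ.≤-trans (Valid.x≤Mx valid {zero} ν∈) (ℕ.<⇒≤ lt)
    extend-root : (∃[ σ₁ ] ∃[ σ ] ∃[ c ] Valid σ₁ c (μ ∷ μs) (σ ∷ τs) × spl σ μ σ₁ c ≡ τ₁) →
                  Preimage (μ ∷ μs) T
    extend-root (σ₁ , σ , c , va , eq) = record
      { τs = σ ∷ τs ; cs = ν ∷ cs ; valid = va ; bounded = λ { zero → ν≤μ ; (suc i) → bounded i }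
      ; run≡ = trans
          (run-root {cs = cs} {τs = τs} ([ inj₂ , inj₁ ]′ (Spliceable.V⁻ (Valid.root-spliceable va)
            (subst (λ τ → ν ∈ vertices τ) (sym eq) ν∈))))
          (trans (cong (λ τ → run τ ν cs μs τs) eq) run≡) }
    extend-other : ∀ j → (∃[ σ ] ∃[ σs ] ∃[ c ] Valid τ₁ ν (μ ∷ μs) (σ ∷ σs) ×
                   c ∈ vertices (lookup σs j) × c ≤ μ × Vec.map (attach σ μ c) σs ≡ τs) →
                   Preimage (μ ∷ μs) T
    extend-other j (σ , σs , c , va , c∈ , c≤μ , eq) = record
      { τs = σ ∷ σs ; cs = c ∷ cs ; valid = va ; bounded = λ { zero → c≤μ ; (suc i) → bounded i }
      ; run≡ = trans
          (run-other {cs = cs} {τs = σs} λ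
            { (inj₁ c∈₁) → case Valid.disjoint va {suc (suc j)} {zero} c∈ c∈₁ of λ ()
            ; (inj₂ c∈σ) → case Valid.disjoint va {suc (suc j)} {suc zero} c∈ c∈σ of λ () })
          (trans (cong (run τ₁ ν cs μs) eq) run≡) }
    choose : ∃[ j ] μ ∈ vertices (lookup (τ₁ ∷ τs) j) → Preimage (μ ∷ μs) T
    choose (zero  , μ∈) = extend-root (back-root mx valid μ∈)
    choose (suc j , μ∈) = extend-other j (back-other mx valid {j} μ∈)

  final : ∀ {μ T} → Maxima (μ ∷ []) → Good T → vertices T ≡ ⊤ → Preimage (μ ∷ []) T
  final {μ} {T} mx g V≡⊤
    with record { T₁ = σ ; T₂ = σ₁ ; c = c ; spliceable = s ; spliced = eq ; x∈ = o∈₁ } ←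
      unsplice-root g (subst (μ ∈_) (sym V≡⊤) ∈⊤) (fixed mx zero)
        (subst (o ∈_) (sym V≡⊤) ∈⊤) (Fin.<⇒≢ (o< mx)) = record
    { τs = σ ∷ [] ; cs = [] ; bounded = λ () ; run≡ = eq
    ; valid = record
      { good = λ { zero → s.good₂ ; (suc zero) → s.good₁ }
      ; disjoint = λ { {zero} {zero} _ _ → refl ; {suc zero} {suc zero} _ _ → refl
                     ; {zero} {suc zero} p q → ⊥-elim (s.disjoint q p)
                     ; {suc zero} {zero} p q → ⊥-elim (s.disjoint p q) }
      ; cover = λ x → [ (suc zero ,_) , (zero ,_) ]′
          (s.V⁻ (subst (λ S → x ∈ vertices S) (sym eq) (all∈ x)))
      ; o∈ = o∈₁ ; ν∈ = s.c∈
      ; μ∈ = λ { zero → s.v∈ }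
      ; connected = λ { zero → s.connected }
      ; low₁ = λ {x} x∈ → case complete mx x of λ
          { (inj₁ lt) → lt
          ; (inj₂ (zero , e)) → ⊥-elim (s.disjoint s.v∈ (subst (_∈ vertices σ₁) e (s.g₂.M∈ x∈))) }
      ; low = λ { zero {x} x∈ → case complete mx x of λ
          { (inj₁ lt) → inj₂ lt ; (inj₂ (zero , e)) → inj₁ e } } } }
    where
    module s = Spliceable s
    all∈ : ∀ x → x ∈ vertices T
    all∈ x = subst (x ∈_) (sym V≡⊤) ∈⊤

  run-surjective : ∀ {n} {μs : Vec (Fin r) (suc n)} {T} → Maxima μs →
                   Good T → vertices T ≡ ⊤ → Preimage μs T
  run-surjective {zero}  {μ ∷ []} mx g V≡⊤ = final mx g V≡⊤
  run-surjective {suc n} {μ ∷ μs} mx g V≡⊤ = extend mx (run-surjective (tail-maxima mx) g V≡⊤)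

-- The initial situation and the bijection

module Bijection {r : ℕ} (π : Π₁ r) where
  open Π₁ π

  index : Fin r → Fin k
  index x = proj₁ (partition x)

  ∈index : ∀ x → x ∈ block (index x)
  ∈index x = proj₁ (proj₂ (partition x))

  index-unique : ∀ {x ℓ} → x ∈ block ℓ → index x ≡ ℓ
  index-unique {x} = proj₂ (proj₂ (partition x))

  M : Fin r → Fin r
  M = μ ∘ index

  index-μ : ∀ ℓ → index (μ ℓ) ≡ ℓ
  index-μ ℓ = index-unique (μ∈block ℓ)

  M-μ : ∀ ℓ → M (μ ℓ) ≡ μ ℓ
  M-μ ℓ = cong μ (index-μ ℓ)

  μ-injective : ∀ {ℓ ℓ′} → μ ℓ ≡ μ ℓ′ → ℓ ≡ ℓ′
  μ-injective {ℓ} {ℓ′} e = trans (sym (index-μ ℓ)) (trans (cong index e) (index-μ ℓ′))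

  toℕ-o : toℕ (μ zero) ≡ 0
  toℕ-o = ℕ.suc-injective (Equivalence.to block₁ (μ∈block zero))

  open Blocks M (λ x → M-μ (index x))
  open States M (λ x → M-μ (index x)) (μ zero) (M-μ zero) (λ x → subst (ℕ._≤ toℕ x) (sym toℕ-o) z≤n)

  ∈block : ∀ {x ℓ} → M x ≡ μ ℓ → x ∈ block ℓ
  ∈block {x} e = subst (λ ℓ → x ∈ block ℓ) (μ-injective e) (∈index x)

  M-block : ∀ {x ℓ} → x ∈ block ℓ → M x ≡ μ ℓ
  M-block x∈ = cong μ (index-unique x∈)

  μs : Vec (Fin r) (suc m)
  μs = tabulate (μ ∘ suc)

  lookup-μs : ∀ j → lookup μs j ≡ μ (suc j)
  lookup-μs = lookup∘tabulate (μ ∘ suc)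

  maxima : Maxima μs
  maxima = record
    { fixed = λ j → subst (λ x → M x ≡ x) (sym (lookup-μs j)) (M-μ (suc j))
    ; mono = λ {j} {k} j<k →
        subst₂ _<_ (sym (lookup-μs j)) (sym (lookup-μs k)) (μ-increasing (s≤s j<k))
    ; o< = μ-increasing (s≤s z≤n)
    ; complete = complete′ }
    where
    complete′ : ∀ x → M x < lookup μs zero ⊎ ∃[ j ] M x ≡ lookup μs j
    complete′ x with index x
    ... | zero  = inj₁ (μ-increasing (s≤s z≤n))
    ... | suc j = inj₂ (j , sym (lookup-μs j))

  τ : Fin k → RawTree r
  τ ℓ = increasingChain (block ℓ)

  τs : Vec (RawTree r) (suc m)
  τs = tabulate (τ ∘ suc)

  lookup-τ : ∀ ℓ → lookup (τ zero ∷ τs) ℓ ≡ τ ℓ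
  lookup-τ = lookup∘tabulate τ

  τ-good : ∀ ℓ → Good (τ ℓ)
  τ-good ℓ = record
    { isTree = chain-isTree (block ℓ) (μ ℓ , μ∈block ℓ)
    ; M∈ = λ x∈ → subst (_∈ block ℓ) (sym (M-block x∈)) (μ∈block ℓ)
    ; M∈⁻ = λ {x} Mx∈ → ∈block (trans (sym (M-μ (index x))) (M-block Mx∈))
    ; ≼M = λ x∈ → subst (τ ℓ ⊢ _ ≼_) (sym (M-block x∈))
        (≤⇒chain≼ (block ℓ) x∈ (μ∈block ℓ) (μ-max ℓ x∈)) }

  -- On a single block `M y` is `μ ℓ`, so `μ ℓ` itself is the witness.
  τ-connected : ∀ ℓ → Connected (τ ℓ) (μ ℓ)
  τ-connected ℓ {y} y≼μ y≢μ with chain≼⇒≤ (block ℓ) y≼μ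
  ... | inj₁ y≡μ = contradiction y≡μ y≢μ
  ... | inj₂ (y∈ , _ , y≤μ) =
    μ ℓ , here , subst (τ ℓ ⊢ μ ℓ ≼_) (sym (M-block y∈)) here , Fin.≤∧≢⇒< y≤μ y≢μ

  initial : Valid (τ zero) (μ zero) μs τs
  initial = record
    { good = λ ℓ → subst Good (sym (lookup-τ ℓ)) (τ-good ℓ)
    ; disjoint = λ {j} {k} p q → trans (sym (index-unique (at j p))) (index-unique (at k q))
    ; cover = λ x → index x , subst (λ T → x ∈ vertices T) (sym (lookup-τ (index x))) (∈index x)
    ; o∈ = μ∈block zero ; ν∈ = μ∈block zero
    ; μ∈ = λ j → subst₂ (λ u T → u ∈ vertices T) (sym (lookup-μs j))
        (sym (lookup-τ (suc j))) (μ∈block (suc j))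
    ; connected = λ j →
        subst₂ Connected (sym (lookup-τ (suc j))) (sym (lookup-μs j)) (τ-connected (suc j))
    ; low₁ = λ x∈ → subst (_< μ (suc zero)) (sym (M-block x∈)) (μ-increasing (s≤s z≤n))
    ; low = λ j x∈ → inj₁ (trans (M-block (at (suc j) x∈)) (sym (lookup-μs j))) }
    where
    at : ∀ ℓ {x} → x ∈ vertices (lookup (τ zero ∷ τs) ℓ) → x ∈ block ℓ
    at ℓ {x} = subst (λ T → x ∈ vertices T) (lookup-τ ℓ)

  -- All vertices of `T` are ancestors of `μ ℓ`, hence ordered by their labels.
  τ-unique : ∀ {T ℓ} → Good T → vertices T ⊆ block ℓ → block ℓ ⊆ vertices T → T ≡ τ ℓ
  τ-unique {T} {ℓ} g V⊆ ⊆V = tree-ext isTree (Good.isTree (τ-good ℓ)) (⊆-antisym V⊆ ⊆V) ⇒ ⇐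
    where
    open Good g
    ⇒ : ∀ {x y} → T ⊢ x ≼ y → τ ℓ ⊢ x ≼ y
    ⇒ p with ≼⇒≡⊎∈ p
    ... | inj₁ refl = here
    ... | inj₂ (x∈ , y∈) = ≤⇒chain≼ (block ℓ) (V⊆ x∈) (V⊆ y∈) (≼⇒≤ p)
    ⇐ : ∀ {x y} → τ ℓ ⊢ x ≼ y → T ⊢ x ≼ y
    ⇐ p with chain≼⇒≤ (block ℓ) p
    ... | inj₁ refl = here
    ... | inj₂ (x∈ , y∈ , x≤y) = ≼-below (≼μ x∈) (≼μ y∈) x≤y
      where
      ≼μ : ∀ {x} → x ∈ block ℓ → T ⊢ x ≼ μ ℓ
      ≼μ {x} x∈ = subst (T ⊢ x ≼_) (M-block x∈) (≼M (⊆V x∈))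

  -- The backward run must end at the initial situation. Maxima below μ₂ belong to the block {1}
  -- only, so `low₁` confines `σ₁` to this block and forces ν; then `low` and disjointness from `σ₁`
  -- leave every other tree just its own block.
  initial-unique : ∀ {σ₁ ν σs} → Valid σ₁ ν μs σs → σ₁ ≡ τ zero × ν ≡ μ zero × σs ≡ τs
  initial-unique {σ₁} {ν} {σs} va =
      τ-unique (good zero) V₁⊆ ⊆V₁ , Fin.toℕ-injective (trans (only-o (V₁⊆ ν∈)) (sym toℕ-o)) ,
      lookup-ext λ j → trans (τ-unique (good (suc j)) (V⊆ j) (⊆V j))
        (sym (lookup∘tabulate (τ ∘ suc) j))
    where
    open Valid va
    only-o : ∀ {x} → x ∈ block zero → toℕ x ≡ 0
    only-o x∈ = ℕ.suc-injective (Equivalence.to block₁ x∈)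
    below : ∀ {x} → M x < μ (suc zero) → x ∈ block zero
    below {x} lt with index x in e
    ... | zero  = subst (λ ℓ → x ∈ block ℓ) e (∈index x)
    ... | suc zero = contradiction lt (ℕ.<-irrefl refl)
    ... | suc (suc j) = contradiction (μ-increasing (s≤s (s≤s z≤n))) (ℕ.<-asym lt)
    V₁⊆ : vertices σ₁ ⊆ block zero
    V₁⊆ x∈ = below (low₁ x∈)
    ⊆V₁ : block zero ⊆ vertices σ₁
    ⊆V₁ x∈ = subst (_∈ vertices σ₁) (Fin.toℕ-injective (trans toℕ-o (sym (only-o x∈)))) o∈
    V⊆ : ∀ j → vertices (lookup σs j) ⊆ block (suc j)
    V⊆ j x∈ with low j x∈
    ... | inj₁ e  = ∈block (trans e (lookup-μs j))
    ... | inj₂ lt with () ← disjoint {zero} {suc j} (⊆V₁ (below lt)) x∈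
    ⊆V : ∀ j → block (suc j) ⊆ vertices (lookup σs j)
    ⊆V j x∈ = Good.M∈⁻ (good (suc j))
      (subst (_∈ V (suc j)) (trans (lookup-μs j) (sym (M-block x∈))) (μ∈ j))

  -- Two elements of a block are both ancestors of its maximum, so the smaller one is above the
  -- larger one.
  good⇒ℰ : ∀ {T} → Good T → vertices T ≡ ⊤ → T ∈ℰ π
  good⇒ℰ {T} g V≡⊤ = record
    { isIncreasingTree = toIncreasing isTree ; spanning = V≡⊤
    ; ancestors = λ ℓ i∈ j∈ i<j → ≼⇒Ancestor (≼-below (≼μ i∈) (≼μ j∈) (ℕ.<⇒≤ i<j)) (Fin.<⇒≢ i<j) }
    where
    open Good g
    ≼μ : ∀ {x ℓ} → x ∈ block ℓ → T ⊢ x ≼ μ ℓ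
    ≼μ {x} x∈ = subst (T ⊢ x ≼_) (M-block x∈) (≼M (subst (x ∈_) (sym V≡⊤) ∈⊤))

  ℰ⇒good : ∀ {T} → T ∈ℰ π → Good T
  ℰ⇒good {T} e = record
    { isTree = fromIncreasing isIncreasingTree
    ; M∈ = λ _ → all∈ ; M∈⁻ = λ _ → all∈ ; ≼M = λ {x} _ → ≼M x }
    where
    open _∈ℰ_ e
    all∈ : ∀ {x} → x ∈ vertices T
    all∈ {x} = subst (x ∈_) (sym spanning) ∈⊤
    ≼M : ∀ x → T ⊢ x ≼ M x
    ≼M x with x Fin.≟ M x
    ... | yes e = subst (T ⊢ x ≼_) e here
    ... | no x≢ = Ancestor⇒≼ (ancestors (index x) (∈index x) (μ∈block (index x))
                    (Fin.≤∧≢⇒< (μ-max (index x) (∈index x)) x≢))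

  bounded : (c : 𝒞 π) → Bounded (proj₁ c) μs
  bounded (c , c≤) i = subst (lookup c i ≤_) (sym (lookup-μs (inject₁ i))) (c≤ i)

  ψ∈ℰ : ∀ c → ψ π c ∈ℰ π
  ψ∈ℰ c = let g , V≡⊤ = run-good (proj₁ c) maxima initial (bounded c) in good⇒ℰ g V≡⊤

  ψ-injective : ∀ {c c′} → ψ π c ≡ ψ π c′ → proj₁ c ≡ proj₁ c′
  ψ-injective {c} {c′} eq = proj₂ (proj₂ (proj₂
    (run-injective (proj₁ c) (proj₁ c′) maxima initial initial (bounded c) (bounded c′) eq)))

  ψ-surjective : ∀ {T} → T ∈ℰ π → Σ[ c ∈ 𝒞 π ] ψ π c ≡ T
  ψ-surjective {T} T∈ = start (run-surjective maxima (ℰ⇒good T∈) (_∈ℰ_.spanning T∈))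
    where
    start : Preimage μs T → Σ[ c ∈ 𝒞 π ] ψ π c ≡ T
    start record { cs = cs ; valid = va ; bounded = bd ; run≡ = run≡ }
      with refl , refl , refl ← initial-unique va =
      (cs , λ i → subst (lookup cs i ≤_) (lookup-μs (inject₁ i)) (bd i)) , run≡

  ψ-isBijection : IsBijection (_≈𝒞_ π) (_≈ℰ_ π) (λ c → ψ π c , ψ∈ℰ c)
  ψ-isBijection = record
    { isInjection = record
      { isCongruent = record
        { cong = cong (λ cs → run (τ zero) (μ zero) cs μs τs)
        ; isEquivalence₁ = On.isEquivalence proj₁ isEquivalence
        ; isEquivalence₂ = On.isEquivalence proj₁ isEquivalence }
      ; injective = λ {c} {c′} → ψ-injective {c} {c′} }
    ; surjective = λ (T , T∈) → let c , eq = ψ-surjective T∈ in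
        c , λ z≈c → trans (cong (λ cs → run (τ zero) (μ zero) cs μs τs) z≈c) eq }

theorem2p8 : (r : ℕ) → 2 ℕ.≤ r → (π : Π₁ r) →
    Σ[ ψ∈ℰ ∈ (∀ c → ψ π c ∈ℰ π) ]
    IsBijection (_≈𝒞_ π) (_≈ℰ_ π) (λ c → ψ π c , ψ∈ℰ c)
theorem2p8 r _ π = ψ∈ℰ , ψ-isBijection
  where open Bijection π
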